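{- As formal power series in $x$, $$\sum_{n\geq 0}|AI_{2n+1}(4123,2341)|\,x^{2n+1}=\sum_{n\geq 0}|RAI_{2n+1}(4123,2341)|\,x^{2n+1}=\frac{x^5-x^3+x}{1-2x^2-x^6},$$ $$\sum_{n\geq 0}|RAI_{2n}(4123,2341)|\,x^{2n}=\frac{1-x^2}{1-2x^2-x^6},$$ and $$\sum_{n\geq 0}|AI_{2n}(4123,2341)|\,x^{2n}=1+\frac{x^4}{1-x^2}+\frac{(x^5-x^3+x)^2}{(1-2x^2-x^6)(1-x^2)}.$$
   Context: Let $S_n$ be the set of permutations $\pi=\pi_1\ldots\pi_n$ of $\{1,\ldots,n\}$ (for $n=0$, only the empty permutation, which is counted in all classes). A permutation is alternating if, for all $1\le i\le n-1$, $\pi_i<\pi_{i+1}$ if and only if $i$ is odd; it is reverse alternating if, for all $1\le i\le n-1$, $\pi_i>\pi_{i+1}$ if and only if $i$ is odd. $AI_n$ (resp. $RAI_n$) is the set of alternating (resp. reverse alternating) involutions ($\pi=\pi^{ -1}$) in $S_n$. A permutation $\pi\in S_n$ avoids the pattern $\tau\in S_k$ if there are no indices $i_1<\cdots<i_k$ such that $\pi_{i_1}\ldots\pi_{i_k}$ is order-isomorphic to $\tau$; $AI_n(\sigma,\tau)$ and $RAI_n(\sigma,\tau)$ are the subsets of elements avoiding both $\sigma$ and $\tau$. (Since $4123=2341^{ -1}$, an involution avoids both patterns if and only if it avoids either one.) -}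

module Defs where

open import Data.Fin.Base using (Fin; zero; suc; toℕ; _<_; finToFun; funToFin; punchIn)
open import Data.Fin.Patterns using (0F; 1F; 2F; 3F)
open import Data.Fin.Permutation using (Permutation′; permutation; _⟨$⟩ʳ_; _⟨$⟩ˡ_; _≈_; id; flip; insert; remove; insert-punchIn; insert-remove)
open import Data.Fin.Properties using (_≟_; _<?_; all?; any?; finToFun-funToFin; punchIn-injective)
open import Data.Integer.Base as ℤ using (ℤ; 0ℤ; 1ℤ)
import Data.Integer.Properties as ℤ
open import Data.List.Base using (List; []; _∷_; [_]; length; filter; allFin; cartesianProductWith)
import Data.List.Membership.Setoid as Membership
open import Data.List.Membership.Propositional.Properties using (∈-allFin)
open import Data.List.Membership.Setoid.Properties using (∈-cartesianProductWith⁺; ∈-resp-≈)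
open import Data.List.Relation.Unary.All using ([])
open import Data.List.Relation.Unary.AllPairs using ([]; _∷_)
open import Data.List.Relation.Unary.Any using (here)
import Data.List.Relation.Unary.Unique.Setoid as Unique
open import Data.List.Relation.Unary.Unique.Propositional.Properties using (allFin⁺)
open import Data.List.Relation.Unary.Unique.Setoid.Properties using (cartesianProductWith⁺)
open import Data.Nat.Base as ℕ using (ℕ; zero; suc; parity)
import Data.Nat.Properties as ℕ
open import Data.Parity.Base using (1ℙ)
import Data.Parity.Properties as ℙ
open import Data.Product.Base using (_×_; _,_; ∃)
open import Data.Vec.Base as Vec using (Vec; []; _∷_; lookup)
open import Function.Base using (_∘_)
open import Function.Bundles using (_⇔_; mk⇔; Equivalence)
open import Level using (0ℓ)
open import Relation.Binary.Bundles using (Setoid)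
open import Relation.Binary.PropositionalEquality as ≡ using (_≡_; _≗_; refl; sym; trans; cong; cong₂; subst₂)
open import Relation.Nullary.Decidable using (Dec; map′; ¬?; True; _×-dec_; _→-dec_)
open import Relation.Nullary.Negation using (¬_)
open import Relation.Unary using (Pred; Decidable)
open import Algebra.Properties.CommutativeMonoid.Sum ℤ.+-0-commutativeMonoid using (sum⁺-syntax; sum-cong-≋)

private
  variable
    k n : ℕ
    A B : Set

-- π ∈ Sₙ acts on Fin n, so the entry πᵢ is π ⟨$⟩ʳ (i - 1), shifted down by
-- one; the position i itself is suc (toℕ (i - 1)).

OddPosition : Fin n → Set
OddPosition i = parity (suc (toℕ i)) ≡ 1ℙ

Alternating : Pred (Permutation′ n) 0ℓ
Alternating π = ∀ i j → toℕ j ≡ suc (toℕ i) →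
  π ⟨$⟩ʳ i < π ⟨$⟩ʳ j ⇔ OddPosition i

ReverseAlternating : Pred (Permutation′ n) 0ℓ
ReverseAlternating π = ∀ i j → toℕ j ≡ suc (toℕ i) →
  π ⟨$⟩ʳ j < π ⟨$⟩ʳ i ⇔ OddPosition i

Involution : Pred (Permutation′ n) 0ℓ
Involution π = π ≈ flip π

IsOccurrence : Permutation′ k → Permutation′ n → (Fin k → Fin n) → Set
IsOccurrence τ π ι =
  (∀ a b → a < b → ι a < ι b) ×
  (∀ a b → (π ⟨$⟩ʳ ι a < π ⟨$⟩ʳ ι b) ⇔ (τ ⟨$⟩ʳ a < τ ⟨$⟩ʳ b))

Avoids : Permutation′ k → Pred (Permutation′ n) 0ℓ
Avoids τ π = ¬ ∃ (IsOccurrence τ π)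

AI : ∀ n → Permutation′ k → Permutation′ k → Pred (Permutation′ n) 0ℓ
AI n σ τ π = (Alternating π × Involution π) × (Avoids σ π × Avoids τ π)

RAI : ∀ n → Permutation′ k → Permutation′ k → Pred (Permutation′ n) 0ℓ
RAI n σ τ π = (ReverseAlternating π × Involution π) × (Avoids σ π × Avoids τ π)

p4123 : Permutation′ 4
p4123 = permutation (lookup (3F ∷ 0F ∷ 1F ∷ 2F ∷ []))
                    (lookup (1F ∷ 2F ∷ 3F ∷ 0F ∷ []))
  (λ { 0F → refl ; 1F → refl ; 2F → refl ; 3F → refl })
  (λ { 0F → refl ; 1F → refl ; 2F → refl ; 3F → refl })

p2341 : Permutation′ 4
p2341 = permutation (lookup (1F ∷ 2F ∷ 3F ∷ 0F ∷ []))
                    (lookup (3F ∷ 0F ∷ 1F ∷ 2F ∷ []))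
  (λ { 0F → refl ; 1F → refl ; 2F → refl ; 3F → refl })
  (λ { 0F → refl ; 1F → refl ; 2F → refl ; 3F → refl })

_⇔?_ : Dec A → Dec B → Dec (A ⇔ B)
a? ⇔? b? = map′ (λ (f , g) → mk⇔ f g)
                (λ e → Equivalence.to e , Equivalence.from e)
                ((a? →-dec b?) ×-dec (b? →-dec a?))

oddPosition? : Decidable (OddPosition {n})
oddPosition? i = parity (suc (toℕ i)) ℙ.≟ 1ℙ

alternating? : Decidable (Alternating {n})
alternating? π = all? λ i → all? λ j → (toℕ j ℕ.≟ suc (toℕ i)) →-dec
  ((π ⟨$⟩ʳ i <? π ⟨$⟩ʳ j) ⇔? oddPosition? i)

reverseAlternating? : Decidable (ReverseAlternating {n})
reverseAlternating? π = all? λ i → all? λ j → (toℕ j ℕ.≟ suc (toℕ i)) →-dec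
  ((π ⟨$⟩ʳ j <? π ⟨$⟩ʳ i) ⇔? oddPosition? i)

involution? : Decidable (Involution {n})
involution? π = all? λ i → π ⟨$⟩ʳ i ≟ π ⟨$⟩ˡ i

isOccurrence? : (τ : Permutation′ k) (π : Permutation′ n) → Decidable (IsOccurrence τ π)
isOccurrence? τ π ι =
  (all? λ a → all? λ b → (a <? b) →-dec (ι a <? ι b)) ×-dec
  (all? λ a → all? λ b →
    (π ⟨$⟩ʳ ι a <? π ⟨$⟩ʳ ι b) ⇔? (τ ⟨$⟩ʳ a <? τ ⟨$⟩ʳ b))

isOccurrence-resp-≗ : (τ : Permutation′ k) (π : Permutation′ n) {ι κ : Fin k → Fin n} →
                      ι ≗ κ → IsOccurrence τ π ι → IsOccurrence τ π κ
isOccurrence-resp-≗ τ π ι≗κ (inc , iso) =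
  (λ a b a<b → subst₂ _<_ (ι≗κ a) (ι≗κ b) (inc a b a<b)) ,
  (λ a b → subst₂ (λ u v → (π ⟨$⟩ʳ u < π ⟨$⟩ʳ v) ⇔ (τ ⟨$⟩ʳ a < τ ⟨$⟩ʳ b))
                  (ι≗κ a) (ι≗κ b) (iso a b))

avoids? : (τ : Permutation′ k) → Decidable (Avoids {n = n} τ)
avoids? τ π = ¬? (map′
  (λ (c , occ) → finToFun c , occ)
  (λ (ι , occ) → funToFin ι , isOccurrence-resp-≗ τ π (sym ∘ finToFun-funToFin ι) occ)
  (any? (isOccurrence? τ π ∘ finToFun)))

AI? : ∀ n (σ τ : Permutation′ k) → Decidable (AI n σ τ)
AI? n σ τ π = (alternating? π ×-dec involution? π) ×-dec (avoids? σ π ×-dec avoids? τ π)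

RAI? : ∀ n (σ τ : Permutation′ k) → Decidable (RAI n σ τ)
RAI? n σ τ π = (reverseAlternating? π ×-dec involution? π) ×-dec (avoids? σ π ×-dec avoids? τ π)

permutations : ∀ n → List (Permutation′ n)
permutations zero    = [ id ]
permutations (suc n) = cartesianProductWith (insert zero) (allFin (suc n)) (permutations n)

∣_∣ : {P : Pred (Permutation′ n) 0ℓ} → Decidable P → ℕ
∣_∣ {n} P? = length (filter P? (permutations n))

-- permutations n lists every element of Sₙ exactly once, up to pointwise
-- equality of permutations.

permutationSetoid : ℕ → Setoid 0ℓ 0ℓ
permutationSetoid n = record
  { Carrier       = Permutation′ n
  ; _≈_           = _≈_
  ; isEquivalence = record
    { refl  = λ _ → refl
    ; sym   = λ p i → sym (p i)
    ; trans = λ p q i → trans (p i) (q i)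
    }
  }

private
  insert-cong : {i j : Fin (suc n)} {π ρ : Permutation′ n} → i ≡ j → π ≈ ρ →
                insert zero i π ≈ insert zero j ρ
  insert-cong refl π≈ρ zero = refl
  insert-cong {i = i} {π = π} {ρ} refl π≈ρ (suc k) =
    trans (insert-punchIn zero i π k)
          (trans (cong (punchIn i) (π≈ρ k)) (sym (insert-punchIn zero i ρ k)))

  insert-injective : {i j : Fin (suc n)} {π ρ : Permutation′ n} →
                     insert zero i π ≈ insert zero j ρ → i ≡ j × π ≈ ρ
  insert-injective {i = i} {π = π} {ρ} eq with refl ← eq zero =
    refl , λ k → punchIn-injective i _ _
      (trans (sym (insert-punchIn zero i π k))
             (trans (eq (suc k)) (insert-punchIn zero i ρ k)))

permutations-complete : (π : Permutation′ n) →
                        let open Membership (permutationSetoid n) in π ∈ permutations n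
permutations-complete {zero}  π = here λ ()
permutations-complete {suc n} π =
  ∈-resp-≈ (permutationSetoid (suc n))
    {x = insert zero (π ⟨$⟩ʳ zero) (remove zero π)} {π} (insert-remove zero π)
  (∈-cartesianProductWith⁺ (≡.setoid _) (permutationSetoid n) (permutationSetoid (suc n))
    (λ {i} {j} {π} {ρ} → insert-cong {π = π} {ρ})
    (∈-allFin (π ⟨$⟩ʳ zero))
    (permutations-complete (remove zero π)))

permutations-unique : ∀ n → Unique.Unique (permutationSetoid n) (permutations n)
permutations-unique zero    = [] ∷ []
permutations-unique (suc n) =
  cartesianProductWith⁺ (≡.setoid _) (permutationSetoid n) (permutationSetoid (suc n))
    (insert zero) (λ {_} {_} {π} {ρ} → insert-injective {π = π} {ρ}) (allFin⁺ (suc n)) (permutations-unique n)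

infixl 6 _+_ _-_
infixl 7 _*_ _/_ _·_
infixr 8 _^_

-- Coefficient sequences; two series are equal when they agree pointwise (_≗_).
PowerSeries : Set
PowerSeries = ℕ → ℤ

𝟙 : PowerSeries
𝟙 zero    = 1ℤ
𝟙 (suc _) = 0ℤ

x : PowerSeries
x zero    = 0ℤ
x (suc n) = 𝟙 n

_+_ : PowerSeries → PowerSeries → PowerSeries
(f + g) n = f n ℤ.+ g n

_-_ : PowerSeries → PowerSeries → PowerSeries
(f - g) n = f n ℤ.- g n

_·_ : ℕ → PowerSeries → PowerSeries
(c · f) n = ℤ.+ c ℤ.* f n

_*_ : PowerSeries → PowerSeries → PowerSeries
(f * g) n = ∑[ i ≤ n ] (f (toℕ i) ℤ.* g (n ℕ.∸ toℕ i))

_^_ : PowerSeries → ℕ → PowerSeries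
f ^ zero  = 𝟙
f ^ suc n = f * f ^ n

-- For g with constant term 1, inverseCoeffs g n = hₙ ∷ … ∷ h₀ where h = 1/g,
-- obtained by solving g₀ hₙ₊₁ + g₁ hₙ + … + gₙ₊₁ h₀ = 0 for hₙ₊₁.
inverseCoeffs : PowerSeries → ∀ n → Vec ℤ (suc n)
inverseCoeffs g zero    = 1ℤ ∷ []
inverseCoeffs g (suc n) = ℤ.- (∑[ i ≤ n ] (g (suc (toℕ i)) ℤ.* lookup hs i)) ∷ hs
  where hs = inverseCoeffs g n

inverse : PowerSeries → PowerSeries
inverse g n = Vec.head (inverseCoeffs g n)

-- Division is defined only when g has constant term 1.
_/_ : (f g : PowerSeries) {_ : True (g 0 ℤ.≟ 1ℤ)} → PowerSeries
f / g = f * inverse g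

private
  lookup-inverseCoeffs : ∀ g n (i : Fin (suc n)) →
                         lookup (inverseCoeffs g n) i ≡ inverse g (n ℕ.∸ toℕ i)
  lookup-inverseCoeffs g zero    zero    = refl
  lookup-inverseCoeffs g (suc n) zero    = refl
  lookup-inverseCoeffs g (suc n) (suc i) = lookup-inverseCoeffs g n i

*-inverse : ∀ g → g 0 ≡ 1ℤ → g * inverse g ≗ 𝟙
*-inverse g g₀≡1 zero    = cong (λ c → c ℤ.* 1ℤ ℤ.+ 0ℤ) g₀≡1
*-inverse g g₀≡1 (suc n) = begin
  g 0 ℤ.* inverse g (suc n) ℤ.+ S′      ≡⟨ cong₂ (λ c s → c ℤ.* inverse g (suc n) ℤ.+ s) g₀≡1 (sym S≡S′) ⟩
  1ℤ ℤ.* (ℤ.- S) ℤ.+ S                  ≡⟨ cong (ℤ._+ S) (ℤ.*-identityˡ (ℤ.- S)) ⟩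
  ℤ.- S ℤ.+ S                           ≡⟨ ℤ.+-inverseˡ S ⟩
  0ℤ                                    ∎
  where
  open ≡.≡-Reasoning
  S  = ∑[ i ≤ n ] (g (suc (toℕ i)) ℤ.* lookup (inverseCoeffs g n) i)
  S′ = ∑[ i ≤ n ] (g (suc (toℕ i)) ℤ.* inverse g (n ℕ.∸ toℕ i))

  S≡S′ : S ≡ S′
  S≡S′ = sum-cong-≋ λ i → cong (g (suc (toℕ i)) ℤ.*_) (lookup-inverseCoeffs g n i)

-- The sum of F 0, F 1, … for a family in which F n is divisible by xⁿ, so
-- that only F 0, …, F m contribute to the coefficient of xᵐ.
infinite-sum : (ℕ → PowerSeries) → PowerSeries
infinite-sum F m = ∑[ n ≤ m ] F (toℕ n) m

infixl 5 infinite-sum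
syntax infinite-sum (λ n → f) = ∑∞[ n ] f

{-# OPTIONS --safe #-}

-- Write a (reverse) alternating involution avoiding 2341 as a function f on positions 0, …, n - 1
-- and put K = f 0, so that f K = 0. Because the value 0 stands at K, the entries to the left of K
-- avoid 123, and the alternation turns this into: the valleys decrease up to K, and so do the peaks
-- after position 0. Using the involution once more, f maps the valleys between 0 and K to each
-- other, hence reverses them, and it does the same with the peaks whose value is below K. Avoiding
-- 2341 forces the values of the remaining peaks to be consecutive numbers, of which there are at
-- most two by the alternation. So K and these high peaks determine the first block of f, and unless
-- the block is everything, it is followed by an arbitrary reverse alternating involution of the
-- class. The resulting recursions are those of the stated rational functions.
module Submission where

-- The constants come from the block lengths, which grow by two with `h`. A nested or linked block
-- ends at a valley, so what follows starts with a peak and is reverse alternating; a final block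
-- ends at a peak, where a direct sum cannot continue. In the reverse alternating case nested blocks
-- have lengths 2, 4, ..., linked ones 6, 8, ... and final ones 5, 7, .... Hence the series R over
-- all lengths satisfies R = 1 + x + x^5/(1 - x^2) + (x^2 + x^6)/(1 - x^2) R. Clearing 1 - x^2 gives
-- the denominator 1 - 2x^2 - x^6 and the numerator (1 - x^2) + (x - x^3 + x^5), whose two brackets
-- are its even and odd parts. In the alternating case the first block is a fixed point, a final
-- block (4, 6, ...) or a linked one (5, 7, ...), so A = 1 + x^4/(1 - x^2) + (x + x^5/(1 - x^2)) R.
-- The factor of R is (x^5 - x^3 + x)/(1 - x^2); multiplied by the odd part of R it produces the
-- square in the last formula. Functions on all of ℕ replace permutations until the counting, so
-- that blocks can be cut off and glued on by plain arithmetic of positions.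

module Involutions where

  open import Data.Empty using (⊥; ⊥-elim)
  open import Data.Fin.Base as Fin using (Fin; toℕ; fromℕ<)
  open import Data.Fin.Patterns using (0F; 1F; 2F; 3F)
  open import Data.Fin.Permutation using (Permutation′; permutation; _⟨$⟩ʳ_; _⟨$⟩ˡ_; _≈_; inverseˡ)
  import Data.Fin.Properties as Fin
  open import Data.List.Base using (List; []; _∷_; [_]; _++_; map; length; filter; lookup)
  open import Data.List.Membership.Propositional.Properties using (∈-lookup)
  open import Data.List.Membership.Setoid.Properties using (∈-filter⁺)
  open import Data.List.Relation.Unary.All as All using (All; []; _∷_)
  import Data.List.Relation.Unary.All.Properties as All
  open import Data.List.Relation.Unary.AllPairs as AllPairs using (AllPairs; []; _∷_)
  import Data.List.Relation.Unary.AllPairs.Properties as AllPairs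
  open import Data.List.Relation.Unary.Any as Any using (Any; here; there)
  import Data.List.Relation.Unary.Any.Properties as Any
  open import Data.Nat.Base using (ℕ; zero; suc; parity; _+_; _*_; _∸_; _≤_; _<_; z≤n; s≤s; z<s; s≤s⁻¹)
  open import Data.Nat.Induction using (<-rec)
  open import Data.Nat.Properties
  open import Data.Parity.Base using (1ℙ)
  open import Data.Parity.Properties using (⁻¹-injective; suc-homo-⁻¹)
  open import Data.Product.Base using (_×_; _,_; ∃; proj₁; proj₂)
  open import Data.Sum.Base using (_⊎_; inj₁; inj₂; [_,_]′)
  open import Data.Vec.Functional using () renaming ([] to []ᶠ; _∷_ to _∷ᶠ_)
  open import Defs using (Involution; Avoids; IsOccurrence; Alternating; ReverseAlternating; OddPosition; AI; RAI; AI?; RAI?; p4123; p2341; ∣_∣; permutations; permutations-complete; permutations-unique; permutationSetoid)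
  open import Function.Base using (_∘_; id)
  open import Function.Bundles using (_⇔_; mk⇔; Equivalence)
  open import Level using (0ℓ)
  open import Relation.Binary.Definitions using (tri<; tri≈; tri>)
  open import Relation.Binary.PropositionalEquality using (_≡_; _≢_; refl; sym; trans; cong; subst; subst₂)
  open import Relation.Nullary.Decidable using (yes; no)
  open import Relation.Nullary.Negation using (¬_; contradiction)
  open import Relation.Unary using (Pred; Decidable)

  -- Blocks of involutions

  -- Positions and values start at 0. The valleys are at the positions r, r + 2, …, so that r = 0
  -- stands for alternating and r = 1 for reverse alternating, where position 0 is an extra peak.
  valley peak : ℕ → ℕ → ℕ
  valley r i = i * 2 + r
  peak r i = suc (valley r i)

  data Place (r q : ℕ) : Set where
    start     : r ≡ 1 → q ≡ 0 → Place r q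
    at-valley : ∀ i → q ≡ valley r i → Place r q
    at-peak   : ∀ i → q ≡ peak r i → Place r q

  place : ∀ {r} → r ≤ 1 → ∀ q → Place r q
  place {zero}        _         zero          = at-valley 0 refl
  place {suc zero}    _         zero          = start refl refl
  place {zero}        _         (suc zero)    = at-peak 0 refl
  place {suc zero}    _         (suc zero)    = at-valley 0 refl
  place {suc (suc _)} (s≤s ())  _
  place {zero}        r≤1       (suc (suc q)) with place r≤1 q
  ... | at-valley i refl = at-valley (suc i) refl
  ... | at-peak i refl   = at-peak (suc i) refl
  place {suc zero}    r≤1       (suc (suc q)) with place r≤1 q
  ... | start _ refl     = at-peak 0 refl
  ... | at-valley i refl = at-valley (suc i) refl
  ... | at-peak i refl   = at-peak (suc i) refl

  module Positions (r : ℕ) where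

    v p : ℕ → ℕ
    v = valley r
    p = peak r

    v≤v : ∀ i j → i ≤ j → v i ≤ v j
    v≤v i j i≤j = +-monoˡ-≤ r (*-monoˡ-≤ 2 i≤j)

    p<v : ∀ i j → i < j → p i < v j
    p<v i j = v≤v (suc i) j

    v<v : ∀ i j → i < j → v i < v j
    v<v i j i<j = <⇒≤ (p<v i j i<j)

    p<p : ∀ i j → i < j → p i < p j
    p<p i j i<j = s≤s (v<v i j i<j)

    v<p : ∀ i j → i ≤ j → v i < p j
    v<p i j i≤j = s≤s (v≤v i j i≤j)

    v<v⁻¹ : ∀ i j → v i < v j → i < j
    v<v⁻¹ i j lt = ≰⇒> λ j≤i → <⇒≱ lt (v≤v j i j≤i)

    p<p⁻¹ : ∀ i j → p i < p j → i < j
    p<p⁻¹ i j lt = v<v⁻¹ i j (s≤s⁻¹ lt)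

    v<p⁻¹ : ∀ i j → v i < p j → i ≤ j
    v<p⁻¹ i j lt = ≮⇒≥ λ j<i → <⇒≱ lt (<⇒≤ (p<v j i j<i))

    p<v⁻¹ : ∀ i j → p i < v j → i < j
    p<v⁻¹ i j lt = v<v⁻¹ i j (<-trans (n<1+n _) lt)

    v-injective : ∀ i j → v i ≡ v j → i ≡ j
    v-injective i j eq with <-cmp i j
    ... | tri< i<j _ _ = contradiction eq (<⇒≢ (v<v i j i<j))
    ... | tri≈ _ i≡j _ = i≡j
    ... | tri> _ _ j<i = contradiction (sym eq) (<⇒≢ (v<v j i j<i))

    p-injective : ∀ i j → p i ≡ p j → i ≡ j
    p-injective i j eq = v-injective i j (suc-injective eq)

    v≢p : ∀ i j → v i ≢ p j
    v≢p i j eq = <⇒≱ (v<v⁻¹ j i (≤-reflexive (sym eq))) (s≤s⁻¹ (v<v⁻¹ i (suc j) (s≤s (≤-reflexive eq))))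

  -- An involution satisfying this also avoids 4123 = 2341⁻¹.
  record Good (r n : ℕ) (f : ℕ → ℕ) : Set where
    field
      bounded    : ∀ {i} → i < n → f i < n
      involutive : ∀ {i} → i < n → f (f i) ≡ i
      avoids2341 : ∀ {a b c d} → a < b → b < c → c < d → d < n →
                   f d < f a → f a < f b → f b < f c → ⊥
      first      : r ≡ 1 → 1 < n → f 1 < f 0
      rise       : ∀ i → peak r i < n → f (valley r i) < f (peak r i)
      fall       : ∀ i → valley r (suc i) < n → f (valley r (suc i)) < f (peak r i)

    injective : ∀ {i j} → i < n → j < n → f i ≡ f j → i ≡ j
    injective i<n j<n eq = trans (sym (involutive i<n)) (trans (cong f eq) (involutive j<n))

  -- With r = 1 and h = 3 (h = 4 for linked), in one-line notation starting at 1: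
  --   nested: 8 6 7 4 5 2 3 1,   final: 8 6 9 4 7 2 5 1 3,   linked: 10 8 12 6 11 4 9 2 7 1 5 3.
  data Shape : Set where
    nested final linked : Shape

  -- `valley r h` is the position `K`, swapped with position 0. The `r` in `inner` accounts for
  -- position 0 being a valley only if `r = 0`: then the reversal includes that swap, whereas for
  -- `r = 1` it concerns the valleys before `K` only.
  record Valleys (r h : ℕ) (f : ℕ → ℕ) : Set where
    field
      top    : f 0 ≡ valley r h
      bottom : f (valley r h) ≡ 0
      inner  : ∀ i j → i + j + r ≡ h → f (valley r i) ≡ valley r j

  -- In a nested block no peak before `K` has a value above `K`; in a final block just the first one
  -- does, and it goes to `K + 1`. A linked block sends the first two peaks to `K + 2` and `K + 1`,
  -- except for `h = 1`, where the first goes to `K + 2` and the second, already at `K + 1`, is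
  -- fixed.
  Peaks : ℕ → ℕ → Shape → (ℕ → ℕ) → Set
  Peaks r h nested f = ∀ i j → suc (i + j) ≡ h → f (peak r i) ≡ peak r j
  Peaks r h final  f = ∀ i j → i + j ≡ h → f (peak r i) ≡ peak r j
  Peaks r h linked f = f (peak r 0) ≡ valley r (suc h)
                     × f (valley r (suc h)) ≡ peak r 0
                     × (∀ i j → suc (i + j) ≡ h → f (peak r (suc i)) ≡ peak r (suc j))

  Block : ℕ → ℕ → Shape → (ℕ → ℕ) → Set
  Block r h s f = Valleys r h f × Peaks r h s f

  -- A size of the form `peak r c` means that the last position is the valley `c`, a size
  -- `valley r (suc c)` that it is the peak `c`. Hence `Classified` asks for equality with `n` in
  -- the final case only.
  size : ℕ → ℕ → Shape → ℕ
  size r h nested = peak r h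
  size r h final  = valley r (suc h)
  size r h linked = peak r (suc h)

  data Classified (r n h : ℕ) (f : ℕ → ℕ) : Set where
    nested : r ≡ 1 → size r h nested ≤ n → Block r h nested f → Classified r n h f
    final  : 1 ≤ h → size r h final ≡ n → Block r h final f → Classified r n h f
    linked : 1 ≤ h → size r h linked ≤ n → Block r h linked f → Classified r n h f

  -- The image of u i has index at most t - i by descent from u 0, at least t - i by ascent from u t.
  reversal : ∀ {f u : ℕ → ℕ} {t} →
             (∀ i j → u i ≡ u j → i ≡ j) →
             (∀ i j → u i < u j → i < j) →
             (∀ i → i ≤ t → ∃ λ j → j ≤ t × f (u i) ≡ u j) →
             (∀ i → i < t → f (u (suc i)) < f (u i)) →
             ∀ i j → i + j ≡ t → f (u i) ≡ u j
  reversal {f} {u} {t} inj cancel total dec i j i+j≡t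
    with total i (subst (i ≤_) i+j≡t (m≤m+n i j))
  ... | k , k≤t , eq = trans eq (cong u (≤-antisym
          (+-cancelˡ-≤ i k j (subst (i + k ≤_) (sym i+j≡t) (upper i k (subst (i ≤_) i+j≡t (m≤m+n i j)) eq)))
          (lower j i k i+j≡t eq)))
    where
    step : ∀ {i k k′} → i < t → f (u i) ≡ u k → f (u (suc i)) ≡ u k′ → k′ < k
    step {i} {k} {k′} i<t eq eq′ = cancel k′ k (subst₂ _<_ eq′ eq (dec i i<t))

    upper : ∀ i k → i ≤ t → f (u i) ≡ u k → i + k ≤ t
    upper zero    k 0≤t  eq with total 0 0≤t
    ... | k′ , k′≤t , eq′ = subst (_≤ t) (inj k′ k (trans (sym eq′) eq)) k′≤t
    upper (suc i) k i<t eq with total i (<⇒≤ i<t)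
    ... | k′ , _ , eq′ = ≤-trans (≤-trans (≤-reflexive (sym (+-suc i k))) (+-monoʳ-≤ i (step i<t eq′ eq))) (upper i k′ (<⇒≤ i<t) eq′)

    lower : ∀ j i k → i + j ≡ t → f (u i) ≡ u k → j ≤ k
    lower zero    i k _  _ = z≤n
    lower (suc j) i k eq′ eq with total (suc i) i<t
      where i<t : i < t
            i<t = ≤-trans (s≤s (m≤m+n i j)) (≤-reflexive (trans (sym (+-suc i j)) eq′))
    ... | k′ , _ , eq″ = ≤-trans (s≤s (lower j (suc i) k′ (trans (sym (+-suc i j)) eq′) eq″))
                                 (step (≤-trans (s≤s (m≤m+n i j)) (≤-reflexive (trans (sym (+-suc i j)) eq′))) eq eq″)

  -- Classification of the first block

  module Analysis {r n h : ℕ} {f : ℕ → ℕ} (r≤1 : r ≤ 1) (good : Good r n f)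
                  (top : f 0 ≡ valley r h) (0<K : 0 < valley r h) (K<n : valley r h < n) where
    open Good good
    open Positions r

    K : ℕ
    K = v h

    0<n : 0 < n
    0<n = <-trans 0<K K<n

    <K⇒<n : ∀ {q} → q < K → q < n
    <K⇒<n q<K = <-trans q<K K<n

    bottom : f K ≡ 0
    bottom = trans (sym (cong f top)) (involutive 0<n)

    f≡0⇒≡K : ∀ {q} → q < n → f q ≡ 0 → q ≡ K
    f≡0⇒≡K q<n fq≡0 = injective q<n K<n (trans fq≡0 (sym bottom))

    f≡K⇒≡0 : ∀ {q} → q < n → f q ≡ K → q ≡ 0
    f≡K⇒≡0 q<n fq≡K = injective q<n 0<n (trans fq≡K (sym top))

    f>0 : ∀ {q} → q < K → 0 < f q
    f>0 q<K = n≢0⇒n>0 λ fq≡0 → <⇒≢ q<K (f≡0⇒≡K (<K⇒<n q<K) fq≡0)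

    avoids123 : ∀ {a b c} → a < b → b < c → c < K → f a < f b → f b < f c → ⊥
    avoids123 a<b b<c c<K = avoids2341 a<b b<c c<K K<n
      (subst (_< f _) (sym bottom) (f>0 (<-trans a<b (<-trans b<c c<K))))

    ≮⇒f> : ∀ {a b} → a < n → b < n → a ≢ b → ¬ f a < f b → f b < f a
    ≮⇒f> a<n b<n a≢b ≮ = ≤∧≢⇒< (≮⇒≥ ≮) λ eq → a≢b (sym (injective b<n a<n eq))

    -- An ascent between neighbouring valleys would continue to the next peak and form a 123 before
    -- `K`. The last step has no such peak, but there the next valley is `K`, with value 0.
    valley-step : ∀ i → i < h → f (v (suc i)) < f (v i)
    valley-step i i<h with m≤n⇒m<n∨m≡n i<h
    ... | inj₂ refl = subst (_< f (v i)) (sym bottom) (f>0 (v<v i h i<h))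
    ... | inj₁ i+1<h = ≮⇒f> (<K⇒<n (v<v i h i<h)) (<K⇒<n (v<v (suc i) h i+1<h)) (<⇒≢ (v<v i (suc i) ≤-refl))
      λ lt → avoids123 (v<v i (suc i) ≤-refl) (n<1+n (v (suc i))) (p<v (suc i) h i+1<h) lt
               (rise (suc i) (<K⇒<n (p<v (suc i) h i+1<h)))

    valley-dec : ∀ i j → i < j → j ≤ h → f (v j) < f (v i)
    valley-dec i (suc j) i<j+1 j<h with m≤n⇒m<n∨m≡n (s≤s⁻¹ i<j+1)
    ... | inj₂ refl = valley-step i j<h
    ... | inj₁ i<j  = <-trans (valley-step j j<h) (valley-dec i j i<j (<⇒≤ j<h))

    -- Dually, an ascent between neighbouring peaks is preceded by the valley `v i`, which completes
    -- a 123.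
    peak-step : ∀ i → suc i < h → f (p (suc i)) < f (p i)
    peak-step i i+1<h = ≮⇒f> (<K⇒<n pi<K) (<K⇒<n (p<v (suc i) h i+1<h)) (<⇒≢ (p<p i (suc i) ≤-refl))
      λ lt → avoids123 (n<1+n (v i)) (p<p i (suc i) ≤-refl) (p<v (suc i) h i+1<h) (rise i (<K⇒<n pi<K)) lt
      where
      pi<K : p i < K
      pi<K = p<v i h (<⇒≤ i+1<h)

    peak-dec : ∀ i j → i < j → j < h → f (p j) < f (p i)
    peak-dec i (suc j) i<j+1 j+1<h with m≤n⇒m<n∨m≡n (s≤s⁻¹ i<j+1)
    ... | inj₂ refl = peak-step i j+1<h
    ... | inj₁ i<j  = <-trans (peak-step j j+1<h) (peak-dec i j i<j (<⇒≤ j+1<h))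

    -- The condition `0 < v i` excludes position 0, which is a valley for `r = 0` and has the value
    -- `K` itself. For `r = 1` the valleys start with a descent from the extra peak.
    valley<K : ∀ i → 0 < v i → i ≤ h → f (v i) < K
    valley<K i 0<vi i≤h with m≤n⇒m<n∨m≡n r≤1
    ... | inj₁ (s≤s z≤n) = subst (f (v i) <_) top (valley-dec 0 i (v<v⁻¹ 0 i 0<vi) i≤h)
    ... | inj₂ refl with i
    ...   | zero   = subst (f 1 <_) top (first refl (≤-trans (s≤s 0<K) K<n))
    ...   | suc i′ = <-trans (valley-dec 0 (suc i′) z<s i≤h) (subst (f 1 <_) top (first refl (≤-trans (s≤s 0<K) K<n)))

    peak>later-valley : ∀ i j → i < j → j < h → f (v j) < f (p i)
    peak>later-valley i (suc j) i<j+1 j+1<h with m≤n⇒m<n∨m≡n (s≤s⁻¹ i<j+1)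
    ... | inj₂ refl = fall j (<K⇒<n (v<v (suc j) h j+1<h))
    ... | inj₁ i<j  = <-trans (fall j (<K⇒<n (v<v (suc j) h j+1<h))) (peak-dec i j i<j (<⇒≤ j+1<h))

    -- If a peak position j < K held the value of a valley position, the value before it would
    -- sit to the left, where neither the decreasing valleys nor the decreasing peaks allow it.
    valley-closed : ∀ i → 0 < v i → i < h → ∃ λ j → f (v i) ≡ v j × 0 < v j × j < h
    valley-closed i 0<vi i<h with place r≤1 (f (v i))
    ... | start _ eq     = contradiction (f≡0⇒≡K (<K⇒<n (v<v i h i<h)) eq) (<⇒≢ (v<v i h i<h))
    ... | at-valley j eq = j , eq , subst (0 <_) eq (f>0 (v<v i h i<h)) , v<v⁻¹ j h (subst (_< K) eq (valley<K i 0<vi (<⇒≤ i<h)))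
    ... | at-peak j eq   = ⊥-elim (impossible (place r≤1 (f (v j))))
      where
      vi<K : v i < K
      vi<K = v<v i h i<h

      pj<K : p j < K
      pj<K = subst (_< K) eq (valley<K i 0<vi (<⇒≤ i<h))

      vj<n : v j < n
      vj<n = <⇒≤ (<K⇒<n pj<K)

      fpj : f (p j) ≡ v i
      fpj = trans (sym (cong f eq)) (involutive (<K⇒<n vi<K))

      z<vi : f (v j) < v i
      z<vi = subst (f (v j) <_) fpj (rise j (<K⇒<n pj<K))

      back : ∀ {z} → f (v j) ≡ z → f z ≡ v j
      back eq′ = trans (sym (cong f eq′)) (involutive vj<n)

      impossible : Place r (f (v j)) → ⊥
      impossible (start _ eq′) = <⇒≢ (<-trans (n<1+n (v j)) pj<K) (trans (sym (back eq′)) top)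
      impossible (at-valley l eq′) = <⇒≱ (valley-dec l i (v<v⁻¹ l i (subst (_< v i) eq′ z<vi)) (<⇒≤ i<h))
        (subst₂ _≤_ (sym (back eq′)) (sym eq) (n≤1+n _))
      impossible (at-peak l eq′) = <⇒≱ (peak>later-valley l i (p<v⁻¹ l i (subst (_< v i) eq′ z<vi)) i<h)
        (subst₂ _≤_ (sym (back eq′)) (sym eq) (n≤1+n _))

    -- For `r = 0` the set being reversed consists of all valleys `0, …, h`, for `r = 1` only of
    -- `0, …, h - 1`, because the partner of `K` is then not a valley.
    inner : ∀ i j → i + j + r ≡ h → f (v i) ≡ v j
    inner i j eq with m≤n⇒m<n∨m≡n r≤1
    ... | inj₁ (s≤s z≤n) = reversal {f} {v} {h} v-injective v<v⁻¹ total valley-step i j (trans (sym (+-identityʳ (i + j))) eq)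
      where
      total : ∀ i → i ≤ h → ∃ λ j → j ≤ h × f (v i) ≡ v j
      total zero    _   = h , ≤-refl , top
      total (suc i) i≤h with m≤n⇒m<n∨m≡n i≤h
      ... | inj₂ refl = 0 , z≤n , bottom
      ... | inj₁ i<h with valley-closed (suc i) z<s i<h
      ...   | j , eq , _ , j<h = j , <⇒≤ j<h , eq
    ... | inj₂ refl = reversal {f} {v} {i + j} v-injective v<v⁻¹ total (λ a a<t → valley-step a (<-trans a<t (≤-reflexive eq″))) i j refl
      where
      eq″ : suc (i + j) ≡ h
      eq″ = trans (+-comm 1 (i + j)) eq
      total : ∀ a → a ≤ i + j → ∃ λ b → b ≤ i + j × f (v a) ≡ v b
      total a a≤t with valley-closed a (m≤n⇒m≤o+n (a * 2) ≤-refl) (subst (a <_) eq″ (s≤s a≤t))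
      ... | b , eq′ , _ , b<h = b , s≤s⁻¹ (subst (b <_) (sym eq″) b<h) , eq′

    valleys : Valleys r h f
    valleys = record { top = top ; bottom = bottom ; inner = inner }

    -- As the peaks before `K` decrease, those with values above `K` form an initial segment; `e` is
    -- its length.
    High : ℕ → Set
    High e = (∀ i → i < e → K < f (p i)) × (∀ i → e ≤ i → i < h → f (p i) < K)

    fp≢K : ∀ i → p i < n → f (p i) ≢ K
    fp≢K i pi<n eq = 1+n≢0 (f≡K⇒≡0 pi<n eq)

    high-peaks : ∃ λ e → e ≤ h × High e
    high-peaks = search h 0 (+-identityʳ h) (λ _ ())
      where
      search : ∀ d i → d + i ≡ h → (∀ j → j < i → K < f (p j)) → ∃ λ e → e ≤ h × High e
      search zero    i refl below = h , ≤-refl , below , λ j h≤j j<h → contradiction h≤j (<⇒≱ j<h)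
      search (suc d) i eq   below with f (p i) <? K
      ... | yes lt = i , <⇒≤ i<h , below , above
        where
        i<h : i < h
        i<h = ≤-trans (s≤s (m≤n+m i d)) (≤-reflexive eq)
        above : ∀ j → i ≤ j → j < h → f (p j) < K
        above j i≤j j<h with m≤n⇒m<n∨m≡n i≤j
        ... | inj₂ refl = lt
        ... | inj₁ i<j  = <-trans (peak-dec i j i<j j<h) lt
      ... | no ≮ = search d (suc i) (trans (+-suc d i) eq) below′
        where
        pi<n : p i < n
        pi<n = <K⇒<n (p<v i h (≤-trans (s≤s (m≤n+m i d)) (≤-reflexive eq)))
        below′ : ∀ j → j < suc i → K < f (p j)
        below′ j j<i+1 with m<1+n⇒m<n∨m≡n j<i+1
        ... | inj₁ j<i  = below j j<i
        ... | inj₂ refl = ≤∧≢⇒< (≮⇒≥ ≮) (fp≢K j pi<n ∘ sym)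

    module WithHigh (e : ℕ) (e≤h : e ≤ h) (high : High e) where

      -- The image lies below `K`. It is no valley, since the valleys there are mapped among
      -- themselves, and no high peak, since those are mapped above `K`.
      low-closed : ∀ i → e ≤ i → i < h → ∃ λ j → f (p i) ≡ p j × e ≤ j × j < h
      low-closed i e≤i i<h = helper (place r≤1 (f (p i)))
        where
        pi<K : p i < K
        pi<K = p<v i h i<h
        fpi<K : f (p i) < K
        fpi<K = proj₂ high i e≤i i<h
        back : ∀ {z} → f (p i) ≡ z → f z ≡ p i
        back eq = trans (sym (cong f eq)) (involutive (<K⇒<n pi<K))
        helper : Place r (f (p i)) → ∃ λ j → f (p i) ≡ p j × e ≤ j × j < h
        helper (start _ eq)     = contradiction (f≡0⇒≡K (<K⇒<n pi<K) eq) (<⇒≢ pi<K)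
        helper (at-valley j eq) with valley-closed j (subst (0 <_) eq (f>0 pi<K)) (v<v⁻¹ j h (subst (_< K) eq fpi<K))
        ... | j′ , eq′ , _ = contradiction (trans (sym eq′) (back eq)) (v≢p j′ i)
        helper (at-peak j eq)   = j , eq , ≮⇒≥ (λ j<e → <-asym (proj₁ high j j<e) (subst (_< K) (sym (back eq)) pi<K))
                                    , p<v⁻¹ j h (subst (_< K) eq fpi<K)

      low-peaks : ∀ i j → suc (i + j) + e ≡ h → f (p (e + i)) ≡ p (e + j)
      low-peaks i j eq = reversal {f} {λ a → p (e + a)} {i + j}
        (λ a b eq′ → +-cancelˡ-≡ e a b (p-injective (e + a) (e + b) eq′))
        (λ a b lt → +-cancelˡ-< e a b (p<p⁻¹ (e + a) (e + b) lt))
        total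
        (λ a a<t → subst (λ z → f (p z) < f (p (e + a))) (sym (+-suc e a))
                     (peak-step (e + a) (≤-trans (s≤s (≤-reflexive (sym (+-suc e a)))) (bound (suc a) a<t))))
        i j refl
        where
        bound : ∀ a → a ≤ i + j → e + a < h
        bound a a≤t = subst (e + a <_) eq (subst (_< suc (i + j) + e) (+-comm a e) (+-monoˡ-< e (s≤s a≤t)))
        total : ∀ a → a ≤ i + j → ∃ λ b → b ≤ i + j × f (p (e + a)) ≡ p (e + b)
        total a a≤t with low-closed (e + a) (m≤m+n e a) (bound a a≤t)
        ... | b , eq′ , e≤b , b<h with m≤n⇒∃[o]m+o≡n e≤b
        ...   | c , refl = c , +-cancelˡ-≤ e c (i + j) (s≤s⁻¹ (subst (e + c <_) (trans (sym eq) (cong suc (+-comm (i + j) e))) b<h)) , eq′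

      back : ∀ {i} → i < e → f (f (p i)) ≡ p i
      back {i} i<e = involutive (<K⇒<n (p<v i h (<-≤-trans i<e e≤h)))

      high<n : ∀ {i} → i < e → f (p i) < n
      high<n {i} i<e = bounded (<K⇒<n (p<v i h (<-≤-trans i<e e≤h)))

      -- `f` leads from `f q` back to `q` above `K`, and among the positions between 0 and `K` only
      -- the high peaks have values above `K`.
      outside : ∀ q → K < q → q < n → f q < K → ∃ λ i → i < e × f (p i) ≡ q
      outside q K<q q<n fq<K = helper (place r≤1 (f q))
        where
        back′ : ∀ {z} → f q ≡ z → f z ≡ q
        back′ eq = trans (sym (cong f eq)) (involutive q<n)
        fq>0 : 0 < f q
        fq>0 = n≢0⇒n>0 λ eq → <⇒≢ K<q (sym (f≡0⇒≡K q<n eq))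
        helper : Place r (f q) → ∃ λ i → i < e × f (p i) ≡ q
        helper (start _ eq)     = contradiction (sym eq) (<⇒≢ fq>0)
        helper (at-valley i eq) = ⊥-elim (<-asym K<q (subst (_< K) (back′ eq)
          (valley<K i (subst (0 <_) eq fq>0) (<⇒≤ (v<v⁻¹ i h (subst (_< K) eq fq<K))))))
        helper (at-peak i eq)   = i , ≰⇒> (λ e≤i → <-asym K<q (subst (_< K) (back′ eq)
          (proj₂ high i e≤i (p<v⁻¹ i h (subst (_< K) eq fq<K))))) , back′ eq

      f≢K : ∀ {q} → K < q → q < n → f q ≢ K
      f≢K K<q q<n eq = <⇒≢ (<-trans 0<K K<q) (sym (f≡K⇒≡0 q<n eq))

      high-dec : ∀ i j → i < j → j < e → f (p j) < f (p i)
      high-dec i j i<j j<e = peak-dec i j i<j (<-≤-trans j<e e≤h)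

      outside-high : ∀ q → K < q → q < n → (∀ i → i < e → f (p i) ≢ q) → K < f q
      outside-high q K<q q<n none = ≤∧≢⇒< (≮⇒≥ λ lt → let i , i<e , eq = outside q K<q q<n lt in none i i<e eq) (f≢K K<q q<n ∘ sym)

      -- Suppose `suc q < Q`. The position `suc q` lies strictly between two neighbouring high
      -- values, so its own value is above `K`. Then the positions `f (v (suc i))`, `q`, `suc q`,
      -- `Q` have the values `v (suc i)`, `p (suc i)`, something above `K`, `p i`, which is a 2341.
      consecutive : ∀ i → suc i < e → f (p i) ≡ suc (f (p (suc i)))
      consecutive i i+1<e = helper (<-cmp (suc q) Q)
        where
        i<e : i < e
        i<e = <⇒≤ i+1<e
        q Q : ℕ
        q = f (p (suc i))
        Q = f (p i)
        i+1<h : suc i < h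
        i+1<h = <-≤-trans i+1<e e≤h
        K<q : K < q
        K<q = proj₁ high (suc i) i+1<e
        q<Q : q < Q
        q<Q = high-dec i (suc i) ≤-refl i+1<e
        vi<K : v (suc i) < K
        vi<K = v<v (suc i) h i+1<h
        helper : _ → Q ≡ suc q
        helper (tri≈ _ eq _) = sym eq
        helper (tri> _ _ gt) = contradiction q<Q (<⇒≱ gt)
        helper (tri< lt _ _) = ⊥-elim (avoids2341 z<q (n<1+n q) lt (high<n i<e)
            (subst₂ _<_ (sym (back i<e)) (sym fz) (p<v i (suc i) ≤-refl))
            (subst₂ _<_ (sym fz) (sym (back i+1<e)) (n<1+n (v (suc i))))
            (subst (_< f (suc q)) (sym (back i+1<e)) (<-trans (p<v (suc i) h i+1<h) K<w)))
          where
          fz : f (f (v (suc i))) ≡ v (suc i)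
          fz = involutive (<K⇒<n vi<K)
          z<q : f (v (suc i)) < q
          z<q = <-trans (valley<K (suc i) z<s (<⇒≤ i+1<h)) K<q
          none : ∀ j → j < e → f (p j) ≢ suc q
          none j j<e eq with <-cmp j i
          ... | tri< j<i _ _  = <⇒≢ (<-trans lt (high-dec j i j<i i<e)) (sym eq)
          ... | tri≈ _ refl _ = <⇒≢ lt (sym eq)
          ... | tri> _ _ i<j with m≤n⇒m<n∨m≡n i<j
          ...   | inj₂ refl  = <⇒≢ (n<1+n q) eq
          ...   | inj₁ i+1<j = <⇒≢ (<-trans (high-dec (suc i) j i+1<j j<e) (n<1+n q)) eq
          K<w : K < f (suc q)
          K<w = outside-high (suc q) (<-trans K<q (n<1+n q)) (<-trans lt (high<n i<e)) none

    classify-nested : ∀ {e} → e ≡ 0 → e ≤ h → High e → Classified r n h f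
    classify-nested refl e≤h high = nested r≡1 K<n (valleys , λ i j eq → low-peaks i j (trans (+-identityʳ _) eq))
      where
      open WithHigh 0 e≤h high
      -- For `r = 0` the first peak rises above `f 0 ≡ K`, so it would be high.
      r≡1 : r ≡ 1
      r≡1 with m≤n⇒m<n∨m≡n r≤1
      ... | inj₂ eq = eq
      ... | inj₁ (s≤s z≤n) = contradiction (proj₂ high 0 z≤n (v<v⁻¹ 0 h 0<K))
            (<-asym (subst (_< f 1) top (rise 0 (≤-trans (s≤s 0<K) K<n))))

    module _ (e : ℕ) (e<h : suc e ≤ h) (high : High (suc e)) where
      open WithHigh (suc e) e<h high

      private
        q : ℕ
        q = f (p e)
        e<e+1 : e < suc e
        e<e+1 = ≤-refl
        K<q : K < q
        K<q = proj₁ high e e<e+1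
        q<n : q < n
        q<n = high<n e<e+1
        pe<K : p e < K
        pe<K = p<v e h e<h
        fq : f q ≡ p e
        fq = back e<e+1

      q-least : ∀ i → i < suc e → q ≤ f (p i)
      q-least i i<e+1 with m<1+n⇒m<n∨m≡n i<e+1
      ... | inj₁ i<e  = <⇒≤ (high-dec i e i<e e<e+1)
      ... | inj₂ refl = ≤-refl

      before-q : ∀ x → K < x → x < q → K < f x
      before-q x K<x x<q = outside-high x K<x (<-trans x<q q<n) λ i i<e+1 eq →
        <⇒≱ x<q (≤-trans (q-least i i<e+1) (≤-reflexive eq))

      -- If `h < j`, the valley `v j` just before `q` lies between `K` and the least high value, so
      -- its value is above `K`. But it has to rise to `f q`, which is `p e < K`.
      q-peak : ∀ j → q ≡ p j → q ≡ p h
      q-peak j q≡pj with m≤n⇒m<n∨m≡n (v<p⁻¹ h j (subst (K <_) q≡pj K<q))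
      ... | inj₂ refl = q≡pj
      ... | inj₁ h<j  = ⊥-elim (<-asym (before-q (v j) (v<v h j h<j) vj<q) (<-trans falls pe<K))
        where
        vj<q : v j < q
        vj<q = ≤-reflexive (sym q≡pj)
        falls : f (v j) < p e
        falls = subst (f (v j) <_) (trans (cong f (sym q≡pj)) fq) (rise j (subst (_< n) q≡pj q<n))

    classify-final : (1≤h : 1 ≤ h) (high : High 1) → f (p 0) ≡ p h → Classified r n h f
    classify-final 1≤h high fp0 = final 1≤h (≤-antisym ph<n (≮⇒≥ λ lt → last lt)) (valleys , peaks)
      where
      open WithHigh 1 1≤h high
      ph<n : p h < n
      ph<n = subst (_< n) fp0 (high<n z<s)
      fph : f (p h) ≡ p 0
      fph = trans (cong f (sym fp0)) (back z<s)
      -- A valley after `p h` would have a value below `p 0`, hence below `K`. By `outside` it would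
      -- then be the value of a high peak, but the only one has the value `p h`.
      last : ¬ v (suc h) < n
      last lt with outside (v (suc h)) (v<v h (suc h) ≤-refl) lt (<-trans (subst (f (v (suc h)) <_) fph (fall h lt)) (p<v 0 h 1≤h))
      ... | zero  , _ , eq = v≢p (suc h) h (trans (sym eq) fp0)
      ... | suc _ , s≤s () , _
      peaks : ∀ i j → i + j ≡ h → f (p i) ≡ p j
      peaks zero    j       refl = fp0
      peaks (suc i) zero    eq   = subst (λ z → f (p z) ≡ p 0) (trans (sym eq) (+-identityʳ (suc i))) fph
      peaks (suc i) (suc j) eq   = low-peaks i j (trans (+-comm (suc (i + j)) 1) (trans (cong suc (sym (+-suc i j))) eq))

    classify-one : (1≤h : 1 ≤ h) (high : High 1) → Classified r n h f
    classify-one 1≤h high = helper (place r≤1 q)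
      where
      open WithHigh 1 1≤h high
      q : ℕ
      q = f (p 0)
      q<n : q < n
      q<n = high<n z<s
      fq : f q ≡ p 0
      fq = back z<s
      K<q : K < q
      K<q = proj₁ high 0 z<s
      p0<K : p 0 < K
      p0<K = p<v 0 h 1≤h
      helper : Place r q → Classified r n h f
      helper (start _ eq)   = contradiction (sym eq) (<⇒≢ (<-trans 0<K K<q))
      helper (at-peak j eq) = classify-final 1≤h high (q-peak 0 1≤h high j eq)
      helper (at-valley j eq) = linked 1≤h vh+1<n (valleys , q≡ , trans (cong f (sym q≡)) fq , centre)
        where
        h<j : h < j
        h<j = v<v⁻¹ h j (subst (K <_) eq K<q)
        ph<q : p h < q
        ph<q = subst (p h <_) (sym eq) (p<v h j h<j)
        K<w : K < f (p h)
        K<w = before-q 0 1≤h high (p h) (n<1+n K) ph<q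
        -- With `p h′` the last peak before `K`, which is low, the positions `f (v h′)`, `f (p h′)`,
        -- `p h`, `q` have the values `v h′`, `p h′`, something above `K`, `p 0`: a 2341.
        h≤1 : ∀ h′ → 1 ≤ h′ → suc h′ ≢ h
        h≤1 h′ 1≤h′ refl = avoids2341
          (rise h′ (<K⇒<n ph′<K)) (<-trans (proj₂ high h′ 1≤h′ ≤-refl) (n<1+n K)) ph<q q<n
          (subst₂ _<_ (sym fq) (sym (involutive (<K⇒<n vh′<K))) (p<v 0 h′ 1≤h′))
          (subst₂ _<_ (sym (involutive (<K⇒<n vh′<K))) (sym (involutive (<K⇒<n ph′<K))) (n<1+n (v h′)))
          (subst (_< f (p h)) (sym (involutive (<K⇒<n ph′<K))) (<-trans ph′<K K<w))
          where
          ph′<K : p h′ < K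
          ph′<K = p<v h′ h ≤-refl
          vh′<K : v h′ < K
          vh′<K = v<v h′ h ≤-refl
        -- If `j` were larger, the positions `0`, `v (suc h)`, `p (suc h)`, `q` would form a 2341:
        -- the values start at `K`, rise twice and end with `p 0 < K`.
        j≡h+1 : j ≡ suc h
        j≡h+1 with m≤n⇒m<n∨m≡n h<j
        ... | inj₂ eq′ = sym eq′
        ... | inj₁ lt = ⊥-elim (avoids2341 (<-trans 0<K K<u) (n<1+n (v (suc h))) ph+1<q q<n
                  (subst₂ _<_ (sym fq) (sym top) p0<K)
                  (subst (_< f (v (suc h))) (sym top) (before-q 0 1≤h high (v (suc h)) K<u (<-trans (n<1+n _) ph+1<q)))
                  (rise (suc h) (<-trans ph+1<q q<n)))
          where
          K<u : K < v (suc h)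
          K<u = v<v h (suc h) ≤-refl
          ph+1<q : p (suc h) < q
          ph+1<q = subst (p (suc h) <_) (sym eq) (p<v (suc h) j lt)
        q≡ : q ≡ v (suc h)
        q≡ = trans eq (cong v j≡h+1)
        vh+1<n : v (suc h) < n
        vh+1<n = subst (_< n) q≡ q<n

        fvh+1 : f (v (suc h)) ≡ p 0
        fvh+1 = trans (cong f (sym q≡)) fq
        ph<n : p h < n
        ph<n = <-trans ph<q q<n
        fixed : f (p h) ≡ p h
        fixed = ≤-antisym (≮⇒≥ too-big) K<w
          where
          -- The value `suc (p h)` is `q`, already taken by `p 0`. A still larger value makes `0`,
          -- `p 0`, `p h`, `v (suc h)` a 2341, with values `K`, `q`, `f (p h)`, `p 0`.
          too-big : ¬ p h < f (p h)
          too-big lt with m≤n⇒m<n∨m≡n lt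
          ... | inj₂ eq′ = <⇒≢ (p<p 0 h 1≤h) (trans (sym fvh+1) (trans (cong f eq′) (involutive ph<n)))
          ... | inj₁ gt  = avoids2341 z<s (p<p 0 h 1≤h) (n<1+n (p h)) vh+1<n
            (subst₂ _<_ (sym fvh+1) (sym top) p0<K)
            (subst (_< q) (sym top) K<q)
            (subst (_< f (p h)) (sym q≡) gt)
        centre : ∀ i j → suc (i + j) ≡ h → f (p (suc i)) ≡ p (suc j)
        centre zero    zero    refl = fixed
        centre (suc i) j       eq′  = contradiction eq′ (h≤1 (suc i + j) (s≤s z≤n))
        centre zero    (suc j) eq′  = contradiction eq′ (h≤1 (suc j) (s≤s z≤n))

    module _ (e : ℕ) (e+2≤h : suc (suc e) ≤ h) (high : High (suc (suc e))) where
      open WithHigh (suc (suc e)) e+2≤h high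

      -- The two least high values are `q` and `suc q`, and `f` maps them to `p (suc e)` and `p e`.
      -- This is a descent from `q` to `suc q`, so `q` cannot be a valley and `q-peak` applies.
      q-descent : f (p (suc e)) ≡ p h × f (p h) ≡ p (suc e) × f (p e) ≡ v (suc h) × f (v (suc h)) ≡ p e
      q-descent = q≡ph , fph , fpe , trans (cong f (sym fpe)) (back e<e+2)
        where
        e<e+2 : e < suc (suc e)
        e<e+2 = n≤1+n (suc e)
        q : ℕ
        q = f (p (suc e))
        Q≡ : f (p e) ≡ suc q
        Q≡ = consecutive e ≤-refl
        q+1<n : suc q < n
        q+1<n = subst (_< n) Q≡ (high<n e<e+2)
        f[q+1]<f[q] : f (suc q) < f q
        f[q+1]<f[q] = subst₂ _<_ (sym (trans (cong f (sym Q≡)) (back e<e+2))) (sym (back ≤-refl)) (p<p e (suc e) ≤-refl)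
        q≡ph : q ≡ p h
        q≡ph with place r≤1 q
        ... | start _ eq     = contradiction (sym eq) (<⇒≢ (<-trans 0<K (proj₁ high (suc e) ≤-refl)))
        ... | at-peak j eq   = q-peak (suc e) e+2≤h high j eq
        ... | at-valley j eq = ⊥-elim (<-asym f[q+1]<f[q] (subst (λ z → f z < f (suc z)) (sym eq) (rise j (subst (λ z → suc z < n) eq q+1<n))))
        fph : f (p h) ≡ p (suc e)
        fph = trans (cong f (sym q≡ph)) (back ≤-refl)
        fpe : f (p e) ≡ v (suc h)
        fpe = trans Q≡ (cong suc q≡ph)

    classify-linked : (2≤h : 2 ≤ h) → High 2 → Classified r n h f
    classify-linked 2≤h high with q-descent 0 2≤h high
    ... | fp1 , fph , fp0 , fvh+1 = linked (<⇒≤ 2≤h) (subst (_< n) fp0 (high<n z<s)) (valleys , fp0 , fvh+1 , peaks)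
      where
      open WithHigh 2 2≤h high
      peaks : ∀ i j → suc (i + j) ≡ h → f (p (suc i)) ≡ p (suc j)
      peaks zero    j       refl = fp1
      peaks (suc i) zero    eq   = subst (λ z → f (p z) ≡ p 1) (trans (sym eq) (cong suc (+-identityʳ (suc i)))) fph
      peaks (suc i) (suc j) eq   = low-peaks i j (trans (+-comm (suc (i + j)) 2) (trans (cong (suc ∘ suc) (sym (+-suc i j))) eq))

    -- The three least high values would be `p h`, `v (suc h)` and `p (suc h)`. The last two are
    -- mapped to `p (suc e)` and `p e`, a descent from a valley to the peak after it.
    at-most-two : ∀ e → suc (suc (suc e)) ≤ h → ¬ High (suc (suc (suc e)))
    at-most-two e e+3≤h high with q-descent (suc e) e+3≤h high
    ... | _ , _ , fpe+1 , fvh+1 = <-asym (p<p e (suc e) ≤-refl) (subst₂ _<_ fvh+1 fph+1 (rise (suc h) ph+1<n))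
      where
      open WithHigh (suc (suc (suc e))) e+3≤h high
      e<e+3 : e < suc (suc (suc e))
      e<e+3 = m≤n⇒m≤o+n 2 ≤-refl
      fpe : f (p e) ≡ p (suc h)
      fpe = trans (consecutive e (n≤1+n _)) (cong suc fpe+1)
      ph+1<n : p (suc h) < n
      ph+1<n = subst (_< n) fpe (high<n e<e+3)
      fph+1 : f (p (suc h)) ≡ p e
      fph+1 = trans (cong f (sym fpe)) (back e<e+3)

    classify : Classified r n h f
    classify with high-peaks
    ... | zero                  , e≤h , high = classify-nested refl e≤h high
    ... | suc zero              , e≤h , high = classify-one e≤h high
    ... | suc (suc zero)        , e≤h , high = classify-linked e≤h high
    ... | suc (suc (suc e)) , e≤h , high = contradiction high (at-most-two e e≤h)

  -- The blocks belong to the class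

  +-swap-< : ∀ {i j a b s} → i + a ≡ s → j + b ≡ s → i < j → b < a
  +-swap-< {i} {j} {a} {b} refl eq i<j = ≰⇒> λ a≤b → <⇒≢ (+-mono-<-≤ i<j a≤b) (sym eq)

  module BlockGood {r h : ℕ} {f : ℕ → ℕ} (r≤1 : r ≤ 1) (0<K : 0 < valley r h) (vs : Valleys r h f) where
    open Positions r
    open Valleys vs

    -- The exceptional valley is `K` for `r = 1`, whose partner is the extra peak at position 0.
    valley-value : ∀ i → i ≤ h → (∃ λ j → i + j + r ≡ h) ⊎ (r ≡ 1 × i ≡ h)
    valley-value i i≤h with m≤n⇒m<n∨m≡n r≤1 | m≤n⇒∃[o]m+o≡n i≤h
    ... | inj₁ (s≤s z≤n) | o     , eq = inj₁ (o , trans (+-identityʳ _) eq)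
    ... | inj₂ refl      | zero  , eq = inj₂ (refl , trans (sym (+-identityʳ i)) eq)
    ... | inj₂ refl      | suc o , eq = inj₁ (o , trans (+-comm (i + o) 1) (trans (sym (+-suc i o)) eq))

    valley≤ : ∀ i → i ≤ h → ∀ j → h ≤ i + j + r → f (v i) ≤ v j
    valley≤ i i≤h j h≤ with valley-value i i≤h
    ... | inj₂ (_ , refl) = subst (_≤ v j) (sym bottom) z≤n
    ... | inj₁ (j′ , eq)  = subst (_≤ v j) (sym (inner i j′ eq))
          (v≤v j′ j (+-cancelˡ-≤ i j′ j (+-cancelʳ-≤ r (i + j′) (i + j) (≤-trans (≤-reflexive eq) h≤))))

    valley≤K : ∀ i → i ≤ h → f (v i) ≤ v h
    valley≤K i i≤h = valley≤ i i≤h h (≤-trans (m≤n+m h i) (m≤m+n (i + h) r))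

    valley<K : ∀ i → 0 < v i → i ≤ h → f (v i) < v h
    valley<K i 0<vi i≤h with valley-value i i≤h
    ... | inj₂ (_ , refl) = subst (_< v h) (sym bottom) 0<K
    ... | inj₁ (j , eq)   = subst (_< v h) (sym (inner i j eq)) (v<v j h (subst (j <_) eq (lemma i r 0<vi)))
      where
      lemma : ∀ i r → 0 < valley r i → j < i + j + r
      lemma zero    (suc r) _ = m<m+n j z<s
      lemma (suc i) r       _ = s≤s (≤-trans (m≤n+m j i) (m≤m+n (i + j) r))

    valley-dec : ∀ i j → i < j → j ≤ h → f (v j) < f (v i)
    valley-dec i j i<j j≤h with valley-value i (<⇒≤ (<-≤-trans i<j j≤h)) | valley-value j j≤h
    ... | inj₂ (_ , refl) | _ = contradiction j≤h (<⇒≱ i<j)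
    ... | inj₁ (a , eq) | inj₁ (b , eq′) = subst₂ _<_ (sym (inner j b eq′)) (sym (inner i a eq))
          (v<v b a (+-swap-< {s = i + a} refl (+-cancelʳ-≡ r (j + b) (i + a) (trans eq′ (sym eq))) i<j))
    ... | inj₁ (a , eq) | inj₂ (refl , refl) = subst₂ _<_ (sym bottom) (sym (inner i a eq)) (≤-trans z<s (m≤n+m 1 (a * 2)))

    valley-involutive : ∀ i → i ≤ h → f (f (v i)) ≡ v i
    valley-involutive i i≤h with valley-value i i≤h
    ... | inj₁ (j , eq)   = trans (cong f (inner i j eq)) (inner j i (trans (cong (_+ r) (+-comm j i)) eq))
    ... | inj₂ (_ , refl) = trans (cong f bottom) top

    start-involutive : f (f 0) ≡ 0
    start-involutive = trans (cong f top) bottom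

    first-descent : r ≡ 1 → f 1 < f 0
    first-descent refl = subst (f 1 <_) (sym top) (valley<K 0 z<s z≤n)

    -- Before the last position there is not even a 123: two of its three positions would be
    -- valleys, or two would be peaks, or one would be the start and another a valley, and each such
    -- pair descends. The last position is left out because the valley ending a linked block breaks
    -- the descent.
    avoids : ∀ {m} → (∀ i → suc (v i) < m → i ≤ h) →
             (∀ i j → i < j → suc (p j) < m → f (p j) < f (p i)) →
             ∀ {a b c d} → a < b → b < c → c < d → d < m → f d < f a → f a < f b → f b < f c → ⊥
    avoids {m} in-range peak-dec {a} {b} {c} a<b b<c c<d d<m _ fa<fb fb<fc =
      cases (place r≤1 a) (place r≤1 b) (place r≤1 c)
      where
      c′ : suc c < m
      c′ = ≤-<-trans c<d d<m
      b′ : suc b < m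
      b′ = <-trans (s≤s b<c) c′
      a<c : a < c
      a<c = <-trans a<b b<c
      fa<fc : f a < f c
      fa<fc = <-trans fa<fb fb<fc

      two-valleys : ∀ {x y} → x < y → suc y < m → f x < f y → ∀ i j → x ≡ v i → y ≡ v j → ⊥
      two-valleys x<y y<m fx<fy i j refl refl = <-asym fx<fy (valley-dec i j (v<v⁻¹ i j x<y) (in-range j y<m))

      two-peaks : ∀ {x y} → x < y → suc y < m → f x < f y → ∀ i j → x ≡ p i → y ≡ p j → ⊥
      two-peaks x<y y<m fx<fy i j refl refl = <-asym fx<fy (peak-dec i j (p<p⁻¹ i j x<y) y<m)

      start-valley : ∀ {x y} → x < y → suc y < m → f x < f y → x ≡ 0 → ∀ j → y ≡ v j → ⊥
      start-valley x<y y<m fx<fy refl j refl = <-asym fx<fy (subst (f (v j) <_) (sym top) (valley<K j x<y (in-range j y<m)))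

      cases : Place r a → Place r b → Place r c → ⊥
      cases _ (start _ eq) _ = n≮0 (subst (a <_) eq a<b)
      cases _ _ (start _ eq) = n≮0 (subst (b <_) eq b<c)
      cases _ (at-valley i eq) (at-valley j eq′) = two-valleys b<c c′ fb<fc i j eq eq′
      cases _ (at-peak i eq) (at-peak j eq′) = two-peaks b<c c′ fb<fc i j eq eq′
      cases (start _ eq) (at-valley j eq′) _ = start-valley a<b b′ fa<fb eq j eq′
      cases (start _ eq) _ (at-valley j eq′) = start-valley a<c c′ fa<fc eq j eq′
      cases (at-valley i eq) (at-valley j eq′) _ = two-valleys a<b b′ fa<fb i j eq eq′
      cases (at-valley i eq) _ (at-valley j eq′) = two-valleys a<c c′ fa<fc i j eq eq′
      cases (at-peak i eq) (at-peak j eq′) _ = two-peaks a<b b′ fa<fb i j eq eq′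
      cases (at-peak i eq) _ (at-peak j eq′) = two-peaks a<c c′ fa<fc i j eq eq′

    nested-good : r ≡ 1 → Peaks r h nested f → Good r (size r h nested) f
    nested-good r≡1 ps = record
      { bounded = bounded ; involutive = involutive
      ; avoids2341 = avoids (λ i lt → v<p⁻¹ i h (<-trans (n<1+n _) lt)) peak-dec
      ; first = λ eq _ → first-descent eq ; rise = rise ; fall = fall }
      where
      peak-value : ∀ i → i < h → ∃ λ j → suc (i + j) ≡ h × f (p i) ≡ p j
      peak-value i i<h with m≤n⇒∃[o]m+o≡n i<h
      ... | j , eq = j , eq , ps i j eq
      bounded : ∀ {q} → q < p h → f q < p h
      bounded {q} q<m with place r≤1 q
      ... | start _ refl     = subst (_< p h) (sym top) ≤-refl
      ... | at-valley i refl = s≤s (valley≤K i (v<p⁻¹ i h q<m))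
      ... | at-peak i refl with peak-value i (p<p⁻¹ i h q<m)
      ...   | j , eq , eq′ = subst (_< p h) (sym eq′) (p<p j h (≤-trans (s≤s (m≤n+m j i)) (≤-reflexive eq)))
      involutive : ∀ {q} → q < p h → f (f q) ≡ q
      involutive {q} q<m with place r≤1 q
      ... | start _ refl     = start-involutive
      ... | at-valley i refl = valley-involutive i (v<p⁻¹ i h q<m)
      ... | at-peak i refl with peak-value i (p<p⁻¹ i h q<m)
      ...   | j , eq , eq′ = trans (cong f eq′) (ps j i (trans (cong suc (+-comm j i)) eq))
      peak-dec : ∀ i j → i < j → suc (p j) < p h → f (p j) < f (p i)
      peak-dec i j i<j lt with peak-value i (<-trans i<j (v<v⁻¹ j h (<-trans (n<1+n _) (s≤s⁻¹ lt)))) | peak-value j (v<v⁻¹ j h (<-trans (n<1+n _) (s≤s⁻¹ lt)))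
      ... | a , eqa , fa | b , eqb , fb = subst₂ _<_ (sym fb) (sym fa) (p<p b a (+-swap-< refl (suc-injective (trans eqb (sym eqa))) i<j))
      rise : ∀ i → p i < p h → f (v i) < f (p i)
      rise i lt with peak-value i (p<p⁻¹ i h lt)
      ... | j , eq , eq′ = subst (f (v i) <_) (sym eq′) (s≤s (valley≤ i (<⇒≤ (p<p⁻¹ i h lt)) j
                             (≤-reflexive (trans (sym eq) (trans (+-comm 1 (i + j)) (cong (i + j +_) (sym r≡1)))))))
      fall : ∀ i → v (suc i) < p h → f (v (suc i)) < f (p i)
      fall i lt with peak-value i (v<p⁻¹ (suc i) h lt)
      ... | j , eq , eq′ = subst (f (v (suc i)) <_) (sym eq′) (s≤s (valley≤ (suc i) (v<p⁻¹ (suc i) h lt) j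
                             (≤-trans (≤-reflexive (sym eq)) (m≤m+n _ r))))

    final-good : Peaks r h final f → Good r (size r h final) f
    final-good ps = record
      { bounded = bounded ; involutive = involutive
      ; avoids2341 = avoids (λ i lt → s≤s⁻¹ (v<v⁻¹ i (suc h) (<-trans (n<1+n _) lt))) peak-dec
      ; first = λ eq _ → first-descent eq ; rise = rise ; fall = fall }
      where
      peak-value : ∀ i → i ≤ h → ∃ λ j → i + j ≡ h × f (p i) ≡ p j
      peak-value i i≤h with m≤n⇒∃[o]m+o≡n i≤h
      ... | j , eq = j , eq , ps i j eq
      bounded : ∀ {q} → q < v (suc h) → f q < v (suc h)
      bounded {q} q<m with place r≤1 q
      ... | start _ refl     = subst (_< v (suc h)) (sym top) (v<v h (suc h) ≤-refl)
      ... | at-valley i refl = s≤s (m≤n⇒m≤1+n (valley≤K i (s≤s⁻¹ (v<v⁻¹ i (suc h) q<m))))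
      ... | at-peak i refl with peak-value i (s≤s⁻¹ (p<v⁻¹ i (suc h) q<m))
      ...   | j , eq , eq′ = subst (_< v (suc h)) (sym eq′) (p<v j (suc h) (s≤s (≤-trans (m≤n+m j i) (≤-reflexive eq))))
      involutive : ∀ {q} → q < v (suc h) → f (f q) ≡ q
      involutive {q} q<m with place r≤1 q
      ... | start _ refl     = start-involutive
      ... | at-valley i refl = valley-involutive i (s≤s⁻¹ (v<v⁻¹ i (suc h) q<m))
      ... | at-peak i refl with peak-value i (s≤s⁻¹ (p<v⁻¹ i (suc h) q<m))
      ...   | j , eq , eq′ = trans (cong f eq′) (ps j i (trans (+-comm j i) eq))
      peak-dec : ∀ i j → i < j → suc (p j) < v (suc h) → f (p j) < f (p i)
      peak-dec i j i<j lt with s≤s⁻¹ (p<v⁻¹ j (suc h) (<-trans (n<1+n _) lt))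
      ... | j≤h with peak-value i (<⇒≤ (<-≤-trans i<j j≤h)) | peak-value j j≤h
      ...   | a , eqa , fa | b , eqb , fb = subst₂ _<_ (sym fb) (sym fa) (p<p b a (+-swap-< eqa eqb i<j))
      rise : ∀ i → p i < v (suc h) → f (v i) < f (p i)
      rise i lt with s≤s⁻¹ (p<v⁻¹ i (suc h) lt)
      ... | i≤h with peak-value i i≤h
      ...   | j , eq , eq′ = subst (f (v i) <_) (sym eq′) (s≤s (valley≤ i i≤h j (≤-trans (≤-reflexive (sym eq)) (m≤m+n _ r))))
      fall : ∀ i → v (suc i) < v (suc h) → f (v (suc i)) < f (p i)
      fall i lt with s≤s⁻¹ (v<v⁻¹ (suc i) (suc h) lt)
      ... | i<h with peak-value i (<⇒≤ i<h)
      ...   | j , eq , eq′ = subst (f (v (suc i)) <_) (sym eq′) (s≤s (valley≤ (suc i) i<h j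
                               (≤-trans (≤-reflexive (sym eq)) (≤-trans (n≤1+n _) (m≤m+n _ r)))))

    linked-good : Peaks r h linked f → Good r (size r h linked) f
    linked-good (fp0 , fvh+1 , ps) = record
      { bounded = bounded ; involutive = involutive
      ; avoids2341 = avoids (λ i lt → s≤s⁻¹ (v<v⁻¹ i (suc h) (s≤s⁻¹ lt))) peak-dec
      ; first = λ eq _ → first-descent eq ; rise = rise ; fall = fall }
      where
      peak-value : ∀ i → i < h → ∃ λ j → suc (i + j) ≡ h × f (p (suc i)) ≡ p (suc j)
      peak-value i i<h with m≤n⇒∃[o]m+o≡n i<h
      ... | j , eq = j , eq , ps i j eq
      value<h : ∀ {i j} → suc (i + j) ≡ h → j < h
      value<h {i} {j} eq = ≤-trans (s≤s (m≤n+m j i)) (≤-reflexive eq)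
      bounded : ∀ {q} → q < p (suc h) → f q < p (suc h)
      bounded {q} q<m with place r≤1 q
      ... | start _ refl = subst (_< p (suc h)) (sym top) (v<p h (suc h) (n≤1+n h))
      ... | at-peak zero refl = subst (_< p (suc h)) (sym fp0) ≤-refl
      ... | at-peak (suc i) refl with peak-value i (s≤s⁻¹ (p<p⁻¹ (suc i) (suc h) q<m))
      ...   | j , eq , eq′ = subst (_< p (suc h)) (sym eq′) (p<p (suc j) (suc h) (s≤s (value<h eq)))
      bounded {q} q<m | at-valley i refl with m≤n⇒m<n∨m≡n (v<p⁻¹ i (suc h) q<m)
      ... | inj₁ i<h+1 = s≤s (≤-trans (valley≤K i (s≤s⁻¹ i<h+1)) (v≤v h (suc h) (n≤1+n h)))
      ... | inj₂ refl  = subst (_< p (suc h)) (sym fvh+1) (p<p 0 (suc h) z<s)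
      involutive : ∀ {q} → q < p (suc h) → f (f q) ≡ q
      involutive {q} q<m with place r≤1 q
      ... | start _ refl = start-involutive
      ... | at-peak zero refl = trans (cong f fp0) fvh+1
      ... | at-peak (suc i) refl with peak-value i (s≤s⁻¹ (p<p⁻¹ (suc i) (suc h) q<m))
      ...   | j , eq , eq′ = trans (cong f eq′) (ps j i (trans (cong suc (+-comm j i)) eq))
      involutive {q} q<m | at-valley i refl with m≤n⇒m<n∨m≡n (v<p⁻¹ i (suc h) q<m)
      ... | inj₁ i<h+1 = valley-involutive i (s≤s⁻¹ i<h+1)
      ... | inj₂ refl  = trans (cong f fvh+1) fp0
      peak-dec : ∀ i j → i < j → suc (p j) < p (suc h) → f (p j) < f (p i)
      peak-dec zero    (suc j) _   lt with peak-value j (s≤s⁻¹ (v<v⁻¹ (suc j) (suc h) (<-trans (n<1+n _) (s≤s⁻¹ lt))))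
      ... | b , eqb , fb = subst₂ _<_ (sym fb) (sym fp0) (p<v (suc b) (suc h) (s≤s (value<h eqb)))
      peak-dec (suc i) (suc j) i<j lt with s≤s⁻¹ (v<v⁻¹ (suc j) (suc h) (<-trans (n<1+n _) (s≤s⁻¹ lt)))
      ... | j<h with peak-value i (<-trans (s≤s⁻¹ i<j) j<h) | peak-value j j<h
      ...   | a , eqa , fa | b , eqb , fb = subst₂ _<_ (sym fb) (sym fa)
              (p<p (suc b) (suc a) (s≤s (+-swap-< refl (suc-injective (trans eqb (sym eqa))) (s≤s⁻¹ i<j))))
      rise : ∀ i → p i < p (suc h) → f (v i) < f (p i)
      rise zero    lt = subst (f (v 0) <_) (sym fp0) (s≤s (m≤n⇒m≤1+n (valley≤K 0 z≤n)))
      rise (suc i) lt with s≤s⁻¹ (p<p⁻¹ (suc i) (suc h) lt)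
      ... | i<h with peak-value i i<h
      ...   | j , eq , eq′ = subst (f (v (suc i)) <_) (sym eq′) (s≤s (valley≤ (suc i) i<h (suc j)
              (≤-trans (≤-reflexive (sym eq)) (≤-trans (s≤s (+-monoʳ-≤ i (n≤1+n j))) (m≤m+n _ r)))))
      fall : ∀ i → v (suc i) < p (suc h) → f (v (suc i)) < f (p i)
      fall i lt with m≤n⇒m<n∨m≡n (s≤s⁻¹ (v<p⁻¹ (suc i) (suc h) lt))
      fall zero    lt | inj₁ i<h = subst (f (v 1) <_) (sym fp0) (s≤s (m≤n⇒m≤1+n (valley≤K 1 i<h)))
      fall (suc i) lt | inj₁ i<h with peak-value i (<⇒≤ i<h)
      ... | j , eq , eq′ = subst (f (v (suc (suc i))) <_) (sym eq′) (s≤s (valley≤ (suc (suc i)) i<h (suc j)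
              (≤-trans (≤-reflexive (sym eq)) (≤-trans (s≤s (≤-trans (+-monoʳ-≤ i (n≤1+n j)) (n≤1+n _))) (m≤m+n _ r)))))
      fall zero    lt | inj₂ refl = subst₂ _<_ (sym fvh+1) (sym fp0) (n<1+n (p 0))
      fall (suc i) lt | inj₂ refl = subst₂ _<_ (sym fvh+1) (sym (ps i 0 (cong suc (+-identityʳ i)))) (p<p 0 1 z<s)

  -- Direct sums

  valley-shift : ∀ r c i → valley r (suc c + i) ≡ peak r c + valley 1 i
  valley-shift r zero    i = cong suc (trans (+-comm 1 (i * 2 + r)) (trans (cong (_+ 1) (+-comm (i * 2) r)) (+-assoc r (i * 2) 1)))
  valley-shift r (suc c) i = cong (suc ∘ suc) (valley-shift r c i)

  peak-shift : ∀ r c i → peak r (suc c + i) ≡ peak r c + peak 1 i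
  peak-shift r c i = trans (cong suc (valley-shift r c i)) (sym (+-suc (peak r c) (valley 1 i)))

  module _ {r c n : ℕ} {f g : ℕ → ℕ} where
    private
      m : ℕ
      m = peak r c

    module _ (tail : ∀ {i} → i < n → f (m + i) ≡ m + g i) where
      open Positions r

      split : Good r m f → Good r (m + n) f → Good 1 n g
      split block good = record
        { bounded    = λ {i} i<n → +-cancelˡ-< m (g i) n (subst (_< m + n) (tail i<n) (G.bounded (+-monoʳ-< m i<n)))
        ; involutive = λ {i} i<n → +-cancelˡ-≡ m (g (g i)) i
            (trans (sym (tail (g-bounded i<n))) (trans (cong f (sym (tail i<n))) (G.involutive (+-monoʳ-< m i<n))))
        ; avoids2341 = λ {a} {b} {c} {d} a<b b<c c<d d<n fd<fa fa<fb fb<fc →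
            let c<n = <-trans c<d d<n ; b<n = <-trans b<c c<n ; a<n = <-trans a<b b<n in
            G.avoids2341 (+-monoʳ-< m a<b) (+-monoʳ-< m b<c) (+-monoʳ-< m c<d) (+-monoʳ-< m d<n)
              (lift d<n a<n fd<fa) (lift a<n b<n fa<fb) (lift b<n c<n fb<fc)
        -- Position `m` is the peak `p c` and `m + 1` the valley after it, so this descent of `f`
        -- becomes the initial descent of `g`.
        ; first      = λ _ 1<n → lower 1<n (<⇒≤ 1<n)
            (subst₂ (λ x y → f x < f y) (+-comm 1 m) (sym (+-identityʳ m))
              (G.fall c (subst (_< m + n) (+-comm m 1) (+-monoʳ-< m 1<n))))
        ; rise       = λ i lt → lower (<⇒≤ lt) lt (subst₂ (λ x y → f x < f y) (valley-shift r c i) (peak-shift r c i)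
                       (G.rise (suc c + i) (subst (_< m + n) (sym (peak-shift r c i)) (+-monoʳ-< m lt))))
        ; fall       = λ i lt → lower lt (<⇒≤ lt) (subst₂ (λ x y → f x < f y)
                         (trans (cong (valley r) (sym (+-suc (suc c) i))) (valley-shift r c (suc i))) (peak-shift r c i)
                       (G.fall (suc c + i) (subst (_< m + n)
                         (sym (trans (cong (valley r) (sym (+-suc (suc c) i))) (valley-shift r c (suc i)))) (+-monoʳ-< m lt))))
        }
        where
        module G = Good good
        g-bounded : ∀ {i} → i < n → g i < n
        g-bounded {i} i<n = +-cancelˡ-< m (g i) n (subst (_< m + n) (tail i<n) (G.bounded (+-monoʳ-< m i<n)))
        lower : ∀ {i j} → i < n → j < n → f (m + i) < f (m + j) → g i < g j
        lower i<n j<n lt = +-cancelˡ-< m _ _ (subst₂ _<_ (tail i<n) (tail j<n) lt)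
        lift : ∀ {i j} → i < n → j < n → g i < g j → f (m + i) < f (m + j)
        lift i<n j<n lt = subst₂ _<_ (sym (tail i<n)) (sym (tail j<n)) (+-monoʳ-< m lt)

      -- Since 2341 is no direct sum, an occurrence lies on one side: its first entry exceeds its
      -- last, while all values on the right exceed those on the left. At the seam a valley is
      -- followed by a peak, as the ascent there demands.
      join : Good r m f → Good 1 n g → Good r (m + n) f
      join block good = record
        { bounded = bounded ; involutive = involutive ; avoids2341 = avoids2341
        ; first = first ; rise = rise ; fall = fall }
        where
        module B = Good block
        module G = Good good
        data Side (q : ℕ) : Set where
          left  : q < m → Side q
          right : ∀ i → i < n → q ≡ m + i → Side q
        side : ∀ {q} → q < m + n → Side q
        side {q} q<m+n with q <? m
        ... | yes q<m = left q<m
        ... | no q≮m with m≤n⇒∃[o]m+o≡n (≮⇒≥ q≮m)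
        ...   | i , refl = right i (+-cancelˡ-< m i n q<m+n) refl
        m≤right : ∀ {i} → i < n → m ≤ f (m + i)
        m≤right i<n = subst (m ≤_) (sym (tail i<n)) (m≤m+n m _)
        lift : ∀ {i j} → i < n → j < n → g i < g j → f (m + i) < f (m + j)
        lift i<n j<n lt = subst₂ _<_ (sym (tail i<n)) (sym (tail j<n)) (+-monoʳ-< m lt)
        lower : ∀ {i j} → i < n → j < n → f (m + i) < f (m + j) → g i < g j
        lower i<n j<n lt = +-cancelˡ-< m _ _ (subst₂ _<_ (tail i<n) (tail j<n) lt)
        bounded : ∀ {q} → q < m + n → f q < m + n
        bounded q< with side q<
        ... | left q<m         = <-≤-trans (B.bounded q<m) (m≤m+n m n)
        ... | right i i<n refl = subst (_< m + n) (sym (tail i<n)) (+-monoʳ-< m (G.bounded i<n))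
        involutive : ∀ {q} → q < m + n → f (f q) ≡ q
        involutive q< with side q<
        ... | left q<m         = B.involutive q<m
        ... | right i i<n refl = trans (cong f (tail i<n)) (trans (tail (G.bounded i<n)) (cong (m +_) (G.involutive i<n)))
        avoids2341 : ∀ {a b c d} → a < b → b < c → c < d → d < m + n → f d < f a → f a < f b → f b < f c → ⊥
        avoids2341 {a} {b} {c} {d} a<b b<c c<d d< fd<fa fa<fb fb<fc with side d<
        ... | left d<m = B.avoids2341 a<b b<c c<d d<m fd<fa fa<fb fb<fc
        ... | right d′ d′<n refl with side (<-trans a<b (<-trans b<c (<-trans c<d d<)))
        ...   | left a<m = <⇒≱ (<-trans fd<fa (B.bounded a<m)) (m≤right d′<n)
        ...   | right a′ a′<n refl with m≤n⇒∃[o]m+o≡n (≤-trans (m≤m+n m a′) (<⇒≤ a<b))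
        ...     | b′ , refl with m≤n⇒∃[o]m+o≡n (≤-trans (m≤m+n m b′) (<⇒≤ b<c))
        ...       | c′ , refl = G.avoids2341 (cancel a<b) (cancel b<c) (cancel c<d) d′<n
                      (lower d′<n a′<n fd<fa) (lower a′<n b′<n fa<fb) (lower b′<n c′<n fb<fc)
          where
          cancel : ∀ {x y} → m + x < m + y → x < y
          cancel = +-cancelˡ-< m _ _
          c′<n : c′ < n
          c′<n = <-trans (cancel c<d) d′<n
          b′<n : b′ < n
          b′<n = <-trans (cancel b<c) c′<n
        first : r ≡ 1 → 1 < m + n → f 1 < f 0
        first refl _ = B.first refl (s≤s (≤-trans z<s (m≤n+m 1 (c * 2))))
        rise : ∀ i → p i < m + n → f (v i) < f (p i)
        rise i lt with <-cmp i c
        ... | tri< i<c _ _ = B.rise i (s≤s (<⇒≤ (p<v i c i<c)))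
        ... | tri≈ _ refl _ with +-cancelˡ-< m 0 n (subst (_< m + n) (sym (+-identityʳ m)) lt)
        ...   | 0<n = <-≤-trans (B.bounded ≤-refl) (subst (λ z → m ≤ f z) (+-identityʳ m) (m≤right 0<n))
        rise i lt | tri> _ _ c<i with m≤n⇒∃[o]m+o≡n c<i
        ... | i′ , refl with +-cancelˡ-< m (peak 1 i′) n (subst (_< m + n) (peak-shift r c i′) lt)
        ...   | pi′<n = subst₂ (λ x y → f x < f y) (sym (valley-shift r c i′)) (sym (peak-shift r c i′))
                          (lift (<⇒≤ pi′<n) pi′<n (G.rise i′ pi′<n))
        fall : ∀ i → v (suc i) < m + n → f (v (suc i)) < f (p i)
        fall i lt with <-cmp i c
        ... | tri< i<c _ _ = B.fall i (s≤s (v≤v (suc i) c i<c))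
        ... | tri≈ _ refl _ with +-cancelˡ-< m 1 n (subst (_< m + n) (+-comm 1 m) lt)
        ...   | 1<n = subst₂ (λ x y → f x < f y) (+-comm m 1) (+-identityʳ m) (lift 1<n (<⇒≤ 1<n) (G.first refl 1<n))
        fall i lt | tri> _ _ c<i with m≤n⇒∃[o]m+o≡n c<i
        ... | i′ , refl with trans (cong (valley r) (sym (+-suc (suc c) i′))) (valley-shift r c (suc i′))
        ...   | eq with +-cancelˡ-< m (valley 1 (suc i′)) n (subst (_< m + n) eq lt)
        ...     | vi′<n = subst₂ (λ x y → f x < f y) (sym eq) (sym (peak-shift r c i′))
                            (lift vi′<n (<⇒≤ vi′<n) (G.fall i′ vi′<n))

  -- Enumeration of the class

  -- This is equality of the permutations represented; values at positions from `n` on are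
  -- arbitrary.
  Agree : ℕ → (ℕ → ℕ) → (ℕ → ℕ) → Set
  Agree n f g = ∀ {i} → i < n → f i ≡ g i

  Agree-sym : ∀ {n f g} → Agree n f g → Agree n g f
  Agree-sym f≈g i<n = sym (f≈g i<n)

  Good-resp : ∀ {r n f g} → Agree n f g → Good r n f → Good r n g
  Good-resp {r} {n} {f} {g} f≈g good = record
    { bounded    = bounded′
    ; involutive = λ i<n → trans (sym (f≈g (bounded′ i<n))) (trans (cong f (sym (f≈g i<n))) (involutive i<n))
    ; avoids2341 = λ a<b b<c c<d d<n fd<fa fa<fb fb<fc →
        let c<n = <-trans c<d d<n ; b<n = <-trans b<c c<n ; a<n = <-trans a<b b<n in
        avoids2341 a<b b<c c<d d<n (from d<n a<n fd<fa) (from a<n b<n fa<fb) (from b<n c<n fb<fc)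
    ; first      = λ r≡1 1<n → to 1<n (<⇒≤ 1<n) (first r≡1 1<n)
    ; rise       = λ i lt → to (<⇒≤ lt) lt (rise i lt)
    ; fall       = λ i lt → to lt (<⇒≤ lt) (fall i lt)
    }
    where
    open Good good
    bounded′ : ∀ {i} → i < n → g i < n
    bounded′ i<n = subst (_< n) (f≈g i<n) (bounded i<n)
    to : ∀ {i j} → i < n → j < n → f i < f j → g i < g j
    to i<n j<n = subst₂ _<_ (f≈g i<n) (f≈g j<n)
    from : ∀ {i j} → i < n → j < n → g i < g j → f i < f j
    from i<n j<n = subst₂ _<_ (sym (f≈g i<n)) (sym (f≈g j<n))

  -- With `h = 0` the final and linked shapes would be 213 and 2143, or 12 and 132 for `r = 0`.
  -- These are direct sums with a shorter first block and would be counted twice.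
  Admissible : ℕ → ℕ → Shape → Set
  Admissible r h nested = r ≡ 1
  Admissible r h final  = 1 ≤ h
  Admissible r h linked = 1 ≤ h

  0<valley : ∀ r h s → Admissible r h s → 0 < valley r h
  0<valley r h       nested refl = m≤n+m 1 (h * 2)
  0<valley r (suc h) final  _    = z<s
  0<valley r (suc h) linked _    = z<s

  block-good : ∀ {r h f} s → r ≤ 1 → Admissible r h s → Block r h s f → Good r (size r h s) f
  block-good {r} {h} nested r≤1 r≡1 (vs , ps) = BlockGood.nested-good r≤1 (0<valley r h nested r≡1) vs r≡1 ps
  block-good {r} {h} final  r≤1 1≤h (vs , ps) = BlockGood.final-good r≤1 (0<valley r h final 1≤h) vs ps
  block-good {r} {h} linked r≤1 1≤h (vs , ps) = BlockGood.linked-good r≤1 (0<valley r h linked 1≤h) vs ps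

  block-unique : ∀ {r h f g} s → r ≤ 1 → Admissible r h s → Block r h s f → Block r h s g → Agree (size r h s) f g
  block-unique {r} {h} {f} {g} s r≤1 adm (vs , ps) (vs′ , ps′) {q} = helper s adm ps ps′
    where
    open Positions r
    module F = Valleys vs
    module G = Valleys vs′
    start-case : f 0 ≡ g 0
    start-case = trans F.top (sym G.top)
    valley-case : ∀ i → i ≤ h → f (v i) ≡ g (v i)
    valley-case i i≤h with BlockGood.valley-value r≤1 (0<valley r h s adm) vs i i≤h
    ... | inj₁ (j , eq)   = trans (F.inner i j eq) (sym (G.inner i j eq))
    ... | inj₂ (_ , refl) = trans F.bottom (sym G.bottom)
    helper : ∀ s → Admissible r h s → Peaks r h s f → Peaks r h s g → q < size r h s → f q ≡ g q
    helper nested _ ps ps′ q<m with place r≤1 q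
    ... | start _ refl     = start-case
    ... | at-valley i refl = valley-case i (v<p⁻¹ i h q<m)
    ... | at-peak i refl with m≤n⇒∃[o]m+o≡n (p<p⁻¹ i h q<m)
    ...   | j , eq = trans (ps i j eq) (sym (ps′ i j eq))
    helper final _ ps ps′ q<m with place r≤1 q
    ... | start _ refl     = start-case
    ... | at-valley i refl = valley-case i (s≤s⁻¹ (v<v⁻¹ i (suc h) q<m))
    ... | at-peak i refl with m≤n⇒∃[o]m+o≡n (s≤s⁻¹ (p<v⁻¹ i (suc h) q<m))
    ...   | j , eq = trans (ps i j eq) (sym (ps′ i j eq))
    helper linked _ (fp0 , fv , ps) (gp0 , gv , ps′) q<m with place r≤1 q
    ... | start _ refl      = start-case
    ... | at-peak zero refl = trans fp0 (sym gp0)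
    ... | at-peak (suc i) refl with m≤n⇒∃[o]m+o≡n (s≤s⁻¹ (p<p⁻¹ (suc i) (suc h) q<m))
    ...   | j , eq = trans (ps i j eq) (sym (ps′ i j eq))
    helper linked _ (fp0 , fv , ps) (gp0 , gv , ps′) q<m | at-valley i refl with m≤n⇒m<n∨m≡n (v<p⁻¹ i (suc h) q<m)
    ... | inj₁ i<h+1 = valley-case i (s≤s⁻¹ i<h+1)
    ... | inj₂ refl  = trans fv (sym gv)

  weave : (V P : ℕ → ℕ) → ℕ → ℕ
  weave V P zero          = V 0
  weave V P (suc zero)    = P 0
  weave V P (suc (suc q)) = weave (V ∘ suc) (P ∘ suc) q

  delay : ℕ → ℕ → (ℕ → ℕ) → ℕ → ℕ
  delay zero    a f q       = f q
  delay (suc r) a f zero    = a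
  delay (suc r) a f (suc q) = delay r a f q

  weave-even : ∀ V P i → weave V P (i * 2) ≡ V i
  weave-even V P zero    = refl
  weave-even V P (suc i) = weave-even (V ∘ suc) (P ∘ suc) i

  weave-odd : ∀ V P i → weave V P (suc (i * 2)) ≡ P i
  weave-odd V P zero    = refl
  weave-odd V P (suc i) = weave-odd (V ∘ suc) (P ∘ suc) i

  delay-+ : ∀ r a f q → delay r a f (q + r) ≡ f q
  delay-+ zero    a f q = cong f (+-identityʳ q)
  delay-+ (suc r) a f q = trans (cong (delay (suc r) a f) (+-suc q r)) (delay-+ r a f q)

  -- The value 0 belongs to `K` when `r = 1`. An index above `h` occurs inside a block only as
  -- `suc h`, the last valley of a linked block.
  valleyValue : ℕ → ℕ → ℕ → ℕ
  valleyValue r h i with i + r ≤? h | i ≤? h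
  ... | yes _ | _     = valley r (h ∸ (i + r))
  ... | no _  | yes _ = 0
  ... | no _  | no _  = peak r 0

  peakValue : ℕ → ℕ → Shape → ℕ → ℕ
  peakValue r h nested i       = peak r (h ∸ suc i)
  peakValue r h final  i       = peak r (h ∸ i)
  peakValue r h linked zero    = valley r (suc h)
  peakValue r h linked (suc i) = peak r (suc (h ∸ suc i))

  block : ℕ → ℕ → Shape → ℕ → ℕ
  block r h s = delay r (valley r h) (weave (valleyValue r h) (peakValue r h s))

  block-isBlock : ∀ r h s → r ≤ 1 → Admissible r h s → Block r h s (block r h s)
  block-isBlock r h s r≤1 adm = record { top = top r≤1 ; bottom = bottom ; inner = inner } , peaks s
    where
    at-v : ∀ s i → block r h s (valley r i) ≡ valleyValue r h i
    at-v s i = trans (delay-+ r _ _ (i * 2)) (weave-even (valleyValue r h) (peakValue r h s) i)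
    at-p : ∀ s i → block r h s (peak r i) ≡ peakValue r h s i
    at-p s i = trans (delay-+ r _ _ (suc (i * 2))) (weave-odd (valleyValue r h) (peakValue r h s) i)
    difference : ∀ i j {s} → i + j ≡ s → s ∸ i ≡ j
    difference i j refl = m+n∸m≡n i j
    inner : ∀ i j → i + j + r ≡ h → block r h s (valley r i) ≡ valley r j
    inner i j eq = trans (at-v s i) value
      where
      eq′ : i + r + j ≡ h
      eq′ = trans (+-assoc i r j) (trans (cong (i +_) (+-comm r j)) (trans (sym (+-assoc i j r)) eq))
      value : valleyValue r h i ≡ valley r j
      value with i + r ≤? h | i ≤? h
      ... | yes _ | _ = cong (valley r) (difference (i + r) j eq′)
      ... | no ≰  | _ = contradiction (subst (i + r ≤_) eq′ (m≤m+n (i + r) j)) ≰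
    top : r ≤ 1 → block r h s 0 ≡ valley r h
    top r≤1 with m≤n⇒m<n∨m≡n r≤1
    ... | inj₁ (s≤s z≤n) = inner 0 h (+-identityʳ h)
    ... | inj₂ refl      = refl
    bottom : block r h s (valley r h) ≡ 0
    bottom with m≤n⇒m<n∨m≡n r≤1
    ... | inj₁ (s≤s z≤n) = inner h 0 (trans (+-identityʳ (h + 0)) (+-identityʳ h))
    ... | inj₂ refl = trans (at-v s h) value
      where
      value : valleyValue 1 h h ≡ 0
      value with h + 1 ≤? h | h ≤? h
      ... | yes lt | _    = contradiction (subst (_≤ h) (+-comm h 1) lt) 1+n≰n
      ... | no _  | yes _ = refl
      ... | no _  | no ≰  = contradiction ≤-refl ≰
    peaks : ∀ s → Peaks r h s (block r h s)
    peaks nested i j eq = trans (at-p nested i) (cong (peak r) (difference (suc i) j eq))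
    peaks final  i j eq = trans (at-p final i) (cong (peak r) (difference i j eq))
    peaks linked = at-p linked 0 , trans (at-v linked (suc h)) value
                 , λ i j eq → trans (at-p linked (suc i)) (cong (peak r ∘ suc) (difference (suc i) j eq))
      where
      value : valleyValue r h (suc h) ≡ peak r 0
      value with suc h + r ≤? h | suc h ≤? h
      ... | yes lt | _      = contradiction (≤-trans (m≤m+n (suc h) r) lt) 1+n≰n
      ... | no _   | yes lt = contradiction lt 1+n≰n
      ... | no _   | no _   = refl

  -- The direct sum, the first summand having length `m`.
  splice : ℕ → (ℕ → ℕ) → (ℕ → ℕ) → ℕ → ℕ
  splice m f g q with q <? m
  ... | yes _ = f q
  ... | no _  = m + g (q ∸ m)

  splice-left : ∀ m f g → Agree m (splice m f g) f
  splice-left m f g {q} q<m with q <? m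
  ... | yes _  = refl
  ... | no q≮m = contradiction q<m q≮m

  splice-right : ∀ m f g i → splice m f g (m + i) ≡ m + g i
  splice-right m f g i with m + i <? m
  ... | yes lt = contradiction (≤-trans (s≤s (m≤m+n m i)) lt) 1+n≰n
  ... | no _   = cong (λ z → m + g z) (m+n∸m≡n m i)

  splice-agree : ∀ {m n f b g} → Agree m f b → (∀ {i} → i < n → f (m + i) ≡ m + g i) → Agree (m + n) f (splice m b g)
  splice-agree {m} {n} {f} {b} {g} f≈b tail {q} q< with q <? m
  ... | yes q<m = f≈b q<m
  ... | no q≮m with m≤n⇒∃[o]m+o≡n (≮⇒≥ q≮m)
  ...   | i , refl = trans (tail (+-cancelˡ-< m i n q<)) (cong (λ z → m + g z) (sym (m+n∸m≡n m i)))

  splice-cancel : ∀ {m n b g g′} → Agree (m + n) (splice m b g) (splice m b g′) → Agree n g g′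
  splice-cancel {m} {n} {b} {g} {g′} eq {i} i<n = +-cancelˡ-≡ m (g i) (g′ i)
    (trans (sym (splice-right m b g i)) (trans (eq (+-monoʳ-< m i<n)) (splice-right m b g′ i)))

  -- family r s h n consists of the members of length size r h s + n whose first block has shape s and
  -- index at least h; larger r n of those of length 1 + r + n with a final or linked first block.
  mutual
    rai : ℕ → List (ℕ → ℕ)
    rai zero          = [ id ]
    rai (suc zero)    = [ id ]
    rai (suc (suc n)) = family 1 nested 0 n ++ larger 1 n

    larger : ℕ → ℕ → List (ℕ → ℕ)
    -- The shortest final block has length `4 + r`, the shortest linked one `5 + r`.
    larger r (suc (suc (suc n))) = family r final 1 n ++ largest r n
    larger r _                   = []

    largest : ℕ → ℕ → List (ℕ → ℕ)
    largest r (suc n) = family r linked 1 n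
    largest r zero    = []

    family : ℕ → Shape → ℕ → ℕ → List (ℕ → ℕ)
    family r s h n = map (splice (size r h s) (block r h s)) (remainders s n) ++ further r s h n

    further : ℕ → Shape → ℕ → ℕ → List (ℕ → ℕ)
    further r s h (suc (suc n)) = family r s (suc h) n
    further r s h _             = []

    remainders : Shape → ℕ → List (ℕ → ℕ)
    -- Nothing follows a final block; `id` represents the empty permutation.
    remainders final  zero    = [ id ]
    remainders final  (suc _) = []
    remainders nested n       = rai n
    remainders linked n       = rai n

  ai : ℕ → List (ℕ → ℕ)
  ai zero    = [ id ]
  ai (suc n) = map (splice 1 id) (rai n) ++ larger 0 n

  -- Soundness of the enumeration

  good-zero : ∀ {r f} → Good r 0 f
  good-zero = record
    { bounded = λ () ; involutive = λ () ; avoids2341 = λ { _ _ _ () } ; first = λ { _ () } ; rise = λ _ () ; fall = λ _ () }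

  good-one : ∀ {r} → Good r 1 id
  good-one = record
    { bounded = id ; involutive = λ _ → refl ; avoids2341 = λ { _ _ (s≤s _) (s≤s ()) }
    ; first = λ { _ (s≤s ()) } ; rise = λ { _ (s≤s ()) } ; fall = λ { _ (s≤s ()) } }

  splice-good : ∀ {r c n b g} → Good r (peak r c) b → Good 1 n g → Good r (peak r c + n) (splice (peak r c) b g)
  splice-good {r} {c} {n} {b} {g} good = join {c = c} (λ {i} _ → splice-right (peak r c) b g i)
    (Good-resp (Agree-sym (splice-left (peak r c) b g)) good)

  size-suc : ∀ r h s → size r (suc h) s ≡ suc (suc (size r h s))
  size-suc r h nested = refl
  size-suc r h final  = refl
  size-suc r h linked = refl

  Admissible-suc : ∀ {r h} s → Admissible r h s → Admissible r (suc h) s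
  Admissible-suc nested r≡1 = r≡1
  Admissible-suc final  _   = s≤s z≤n
  Admissible-suc linked _   = s≤s z≤n

  size-further : ∀ r h s n → size r (suc h) s + n ≡ size r h s + suc (suc n)
  size-further r h s n = trans (cong (_+ n) (size-suc r h s))
    (trans (cong suc (sym (+-suc (size r h s) n))) (sym (+-suc (size r h s) (suc n))))

  size-final : ∀ r n → size r 1 final + n ≡ suc (r + (3 + n))
  size-final r n = cong suc (trans (cong (_+ n) (+-comm 3 r)) (+-assoc r 3 n))

  size-linked : ∀ r n → size r 1 linked + n ≡ suc (r + (4 + n))
  size-linked r n = cong suc (trans (cong (_+ n) (+-comm 4 r)) (+-assoc r 4 n))

  mutual
    rai-good : ∀ n → All (Good 1 n) (rai n)
    rai-good zero          = good-zero ∷ []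
    rai-good (suc zero)    = good-one ∷ []
    rai-good (suc (suc n)) = All.++⁺ (family-good nested 0 n ≤-refl refl) (larger-good 1 n ≤-refl)

    larger-good : ∀ r n → r ≤ 1 → All (Good r (suc (r + n))) (larger r n)
    larger-good r (suc (suc (suc n))) r≤1 = All.++⁺
      (subst (λ m → All (Good r m) (family r final 1 n)) (size-final r n) (family-good final 1 n r≤1 ≤-refl))
      (largest-good r n r≤1)
    larger-good r zero             _ = []
    larger-good r (suc zero)       _ = []
    larger-good r (suc (suc zero)) _ = []

    largest-good : ∀ r n → r ≤ 1 → All (Good r (suc (r + (3 + n)))) (largest r n)
    largest-good r zero    _   = []
    largest-good r (suc n) r≤1 =
      subst (λ m → All (Good r m) (family r linked 1 n)) (size-linked r n) (family-good linked 1 n r≤1 ≤-refl)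

    family-good : ∀ {r} s h n → r ≤ 1 → Admissible r h s → All (Good r (size r h s + n)) (family r s h n)
    family-good {r} s h n r≤1 adm = All.++⁺ (All.map⁺ (here-good s h n r≤1 adm)) (further-good s h n r≤1 adm)

    further-good : ∀ {r} s h n → r ≤ 1 → Admissible r h s → All (Good r (size r h s + n)) (further r s h n)
    further-good s h zero          _ _ = []
    further-good s h (suc zero)    _ _ = []
    further-good {r} s h (suc (suc n)) r≤1 adm = subst (λ m → All (Good r m) (family r s (suc h) n)) (size-further r h s n)
      (family-good s (suc h) n r≤1 (Admissible-suc s adm))

    here-good : ∀ {r} s h n → r ≤ 1 → Admissible r h s →
                All (λ g → Good r (size r h s + n) (splice (size r h s) (block r h s) g)) (remainders s n)
    here-good {r} nested h n r≤1 adm =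
      All.map (splice-good {c = h} (block-good nested r≤1 adm (block-isBlock r h nested r≤1 adm))) (rai-good n)
    here-good {r} linked h n r≤1 adm =
      All.map (splice-good {c = suc h} (block-good linked r≤1 adm (block-isBlock r h linked r≤1 adm))) (rai-good n)
    here-good {r} final h zero r≤1 adm =
      subst (λ m → Good r m (splice (size r h final) (block r h final) id)) (sym (+-identityʳ (size r h final)))
        (Good-resp (Agree-sym (splice-left (size r h final) (block r h final) id))
          (block-good final r≤1 adm (block-isBlock r h final r≤1 adm))) ∷ []
    here-good final h (suc n) _ _ = []

  ai-good : ∀ n → All (Good 0 n) (ai n)
  ai-good zero    = good-zero ∷ []
  ai-good (suc n) = All.++⁺ (All.map⁺ (All.map (splice-good {c = 0} good-one) (rai-good n))) (larger-good 0 n z≤n)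

  -- Completeness of the enumeration

  Listed : ℕ → (ℕ → ℕ) → List (ℕ → ℕ) → Set
  Listed n f = Any (Agree n f)

  family-there : ∀ {r s n m f} k {h} → Listed m f (map (splice (size r (k + h) s) (block r (k + h) s)) (remainders s n)) →
                 Listed m f (family r s h (k * 2 + n))
  family-there zero        found = Any.++⁺ˡ found
  family-there {r} {s} {n} {m} {f} (suc k) {h} found =
    Any.++⁺ʳ (map (splice (size r h s) (block r h s)) (remainders s (suc k * 2 + n)))
      (family-there k (subst (λ x → Listed m f (map (splice (size r x s) (block r x s)) (remainders s n))) (sym (+-suc k h)) found))

  -- `f` maps the positions below `m` to themselves, so a value below `m` at `m + i` could not lead
  -- back to `m + i`.
  tail-of : ∀ {r m n f} → Good r m f → Good r (m + n) f → ∀ {i} → i < n → f (m + i) ≡ m + (f (m + i) ∸ m)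
  tail-of {m = m} {f = f} block good {i} i<n = sym (m+[n∸m]≡n (≮⇒≥ λ lt →
    m+n≮m m i (subst (_< m) (G.involutive (+-monoʳ-< m i<n)) (B.bounded lt))))
    where
    module B = Good block
    module G = Good good

  -- The completeness of `rai` at smaller lengths is a parameter, so that both cases can share the
  -- module: `rai-complete` supplies its induction hypothesis, `ai-complete` the finished
  -- `rai-complete`.
  module Completeness {r n : ℕ} {f : ℕ → ℕ} (r≤1 : r ≤ 1) (good : Good r (suc (r + n)) f)
                      (ih : ∀ k {g} → k < suc (r + n) → Good 1 k g → Listed k g (rai k)) where

    spliced : ∀ {m k} b xs → Good r m b → Agree m f b → m + k ≡ suc (r + n) →
              (∀ {g} → Good 1 k g → Listed k g xs) → (∃ λ c → m ≡ peak r c) →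
              Listed (suc (r + n)) f (map (splice m b) xs)
    spliced {m} {k} b xs good-b f≈b eq listed (c , refl) =
      subst (λ z → Listed z f (map (splice m b) xs)) eq
        (Any.map⁺ (Any.map (λ {g} g≈ {q} → splice-agree {g = g} f≈b (λ {i} i<k → trans (tail i<k) (cong (m +_) (g≈ i<k))) {q})
          (listed (split {c = c} tail good-m good′))))
      where
      good-m : Good r m f
      good-m = Good-resp (Agree-sym f≈b) good-b
      good′ : Good r (m + k) f
      good′ = subst (λ z → Good r z f) (sym eq) good
      tail : ∀ {i} → i < k → f (m + i) ≡ m + (f (m + i) ∸ m)
      tail = tail-of good-m good′

    block-listed : ∀ {h k} s → Admissible r h s → Block r h s f → size r h s + k ≡ suc (r + n) →
                   (∀ {g} → Good 1 k g → Listed k g (remainders s k)) → (∃ λ c → size r h s ≡ peak r c) →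
                   Listed (suc (r + n)) f (map (splice (size r h s) (block r h s)) (remainders s k))
    block-listed {h} s adm b eq = spliced (block r h s) _ (block-good s r≤1 adm b′) (block-unique s r≤1 adm b b′) eq
      where
      b′ : Block r h s (block r h s)
      b′ = block-isBlock r h s r≤1 adm

    nested-listed : ∀ {h} → r ≡ 1 → size r h nested ≤ suc (r + n) → Block r h nested f → Listed (suc (r + n)) f (family r nested 0 n)
    nested-listed {h} refl size≤ b with m≤n⇒∃[o]m+o≡n size≤
    ... | k , eq = subst (λ z → Listed (suc (suc n)) f (family 1 nested 0 z)) eq′
          (family-there h (subst (λ z → Listed (suc (suc n)) f (map (splice (size 1 z nested) (block 1 z nested)) (rai k)))
            (sym (+-identityʳ h))
            (block-listed nested refl b eq (ih k (≤-trans (s≤s (m≤n+m k _)) (≤-reflexive eq))) (h , refl))))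
      where
      eq′ : h * 2 + k ≡ n
      eq′ = suc-injective (trans (cong (_+ k) (+-comm 1 (h * 2))) (suc-injective eq))

    final-listed : ∀ {h} → 1 ≤ h → size r h final ≡ suc (r + n) → Block r h final f → Listed (suc (r + n)) f (larger r n)
    final-listed {suc h} _ size≡ b = subst (λ z → Listed (suc (r + n)) f (larger r z)) eq
      (Any.++⁺ˡ (subst (λ z → Listed (suc (r + n)) f (family r final 1 z)) (+-identityʳ (h * 2))
        (family-there h (subst (λ z → Listed (suc (r + n)) f (map (splice (size r z final) (block r z final)) [ id ]))
          (+-comm 1 h) (here agree)))))
      where
      b′ : Block r (suc h) final (block r (suc h) final)
      b′ = block-isBlock r (suc h) final r≤1 (s≤s z≤n)
      agree : Agree (suc (r + n)) f (splice (size r (suc h) final) (block r (suc h) final) id)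
      agree {i} i< = trans (block-unique final r≤1 (s≤s z≤n) b b′ (subst (i <_) (sym size≡) i<))
        (sym (splice-left _ (block r (suc h) final) id (subst (i <_) (sym size≡) i<)))
      eq : 3 + h * 2 ≡ n
      eq = +-cancelˡ-≡ r _ _ (suc-injective (trans (cong suc (+-comm r (3 + h * 2))) size≡))

    linked-listed : ∀ {h} → 1 ≤ h → size r h linked ≤ suc (r + n) → Block r h linked f → Listed (suc (r + n)) f (larger r n)
    linked-listed {suc h} _ size≤ b with m≤n⇒∃[o]m+o≡n size≤
    ... | k , eq = subst (λ z → Listed (suc (r + n)) f (larger r z)) eq′
          (Any.++⁺ʳ (family r final 1 (suc (h * 2 + k))) (family-there h
            (subst (λ z → Listed (suc (r + n)) f (map (splice (size r z linked) (block r z linked)) (rai k))) (+-comm 1 h)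
              (block-listed linked (s≤s z≤n) b eq (ih k (≤-trans (s≤s (m≤n+m k _)) (≤-reflexive eq))) (suc (suc h) , refl)))))
      where
      eq′ : 4 + (h * 2 + k) ≡ n
      eq′ = +-cancelˡ-≡ r _ _ (suc-injective (trans (cong suc (trans (sym (+-assoc r (4 + h * 2) k)) (cong (_+ k) (+-comm r (4 + h * 2))))) eq))

    -- f 0 cannot be a peak position: there the value 0 would sit above its left neighbour.
    f0-not-peak : ∀ h → f 0 ≢ peak r h
    f0-not-peak h eq = n≮0 (subst (f (valley r h) <_) (trans (cong f (sym eq)) (Good.involutive good z<s))
      (Good.rise good h (subst (_< suc (r + n)) eq (Good.bounded good z<s))))

    classified : ∀ h → f 0 ≡ valley r h → 0 < valley r h → Classified r (suc (r + n)) h f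
    classified h eq 0<K = Analysis.classify r≤1 good eq 0<K (subst (_< suc (r + n)) eq (Good.bounded good z<s))

  rai-complete : ∀ n {f} → Good 1 n f → Listed n f (rai n)
  rai-complete = <-rec _ complete
    where
    complete : ∀ n → (∀ {k} → k < n → ∀ {f} → Good 1 k f → Listed k f (rai k)) → ∀ {f} → Good 1 n f → Listed n f (rai n)
    complete zero          _  _    = here λ ()
    complete (suc zero)    _  good = here λ { {zero} _ → n<1⇒n≡0 (Good.bounded good z<s) ; {suc _} (s≤s ()) }
    complete (suc (suc n)) ih {f} good with place {1} ≤-refl (f 0)
    ... | start _ eq   = contradiction (subst (f 1 <_) eq (Good.first good refl (s≤s (s≤s z≤n)))) n≮0
    ... | at-peak h eq = contradiction eq (Completeness.f0-not-peak ≤-refl good (λ k k< → ih k<) h)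
    ... | at-valley h eq with Completeness.classified ≤-refl good (λ k k< → ih k<) h eq (m≤n+m 1 (h * 2))
    ...   | nested r≡1 size≤ b = Any.++⁺ˡ (Completeness.nested-listed ≤-refl good (λ k k< → ih k<) r≡1 size≤ b)
    ...   | final 1≤h size≡ b  = Any.++⁺ʳ (family 1 nested 0 n) (Completeness.final-listed ≤-refl good (λ k k< → ih k<) 1≤h size≡ b)
    ...   | linked 1≤h size≤ b = Any.++⁺ʳ (family 1 nested 0 n) (Completeness.linked-listed ≤-refl good (λ k k< → ih k<) 1≤h size≤ b)

  ai-complete : ∀ n {f} → Good 0 n f → Listed n f (ai n)
  ai-complete zero        _    = here λ ()
  ai-complete (suc n) {f} good with place {0} z≤n (f 0)
  ... | start () _
  ... | at-peak h eq = contradiction eq (Completeness.f0-not-peak z≤n good (λ k _ → rai-complete k) h)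
  -- Here `f 0 ≡ 0`, so `K` is 0 and the first block is a single fixed point, outside the range of
  -- `Analysis`.
  ... | at-valley zero eq = Any.++⁺ˡ (Completeness.spliced z≤n good (λ k _ → rai-complete k) id (rai n) good-one
          (λ { {zero} _ → eq ; {suc _} (s≤s ()) }) refl (rai-complete n) (0 , refl))
  ... | at-valley (suc h) eq with Completeness.classified z≤n good (λ k _ → rai-complete k) (suc h) eq z<s
  ...   | nested () _ _
  ...   | final 1≤h size≡ b  = Any.++⁺ʳ (map (splice 1 id) (rai n)) (Completeness.final-listed z≤n good (λ k _ → rai-complete k) 1≤h size≡ b)
  ...   | linked 1≤h size≤ b = Any.++⁺ʳ (map (splice 1 id) (rai n)) (Completeness.linked-listed z≤n good (λ k _ → rai-complete k) 1≤h size≤ b)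

  -- f 0 determines h, and f at the first peak position determines the shape.
  Signature : ℕ → Shape → ℕ → (ℕ → ℕ) → Set
  Signature r nested h f = f 0 ≡ valley r h × (∀ k → h ≡ suc k → f (peak r 0) ≡ peak r k)
  Signature r final  h f = f 0 ≡ valley r h × f (peak r 0) ≡ peak r h
  Signature r linked h f = f 0 ≡ valley r h × f (peak r 0) ≡ valley r (suc h)

  signature-0 : ∀ {r h f} s → Signature r s h f → f 0 ≡ valley r h
  signature-0 nested = proj₁
  signature-0 final  = proj₁
  signature-0 linked = proj₁

  SignatureFrom : ℕ → Shape → ℕ → (ℕ → ℕ) → Set
  SignatureFrom r s h f = ∃ λ k → h ≤ k × Signature r s k f

  size>0 : ∀ r h s → 0 < size r h s
  size>0 r h nested = z<s
  size>0 r h final  = z<s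
  size>0 r h linked = z<s

  block-signature : ∀ {r h f g} s → Agree (size r h s) f g → Block r h s g → Signature r s h f
  block-signature {r} {h} {f} {g} nested f≈g (vs , ps) = trans (f≈g z<s) (Valleys.top vs) , first-peak h f≈g ps
    where
    first-peak : ∀ h → Agree (size r h nested) f g → Peaks r h nested g → ∀ k → h ≡ suc k → f (peak r 0) ≡ peak r k
    first-peak _ f≈g ps k refl = trans (f≈g (s≤s (s≤s (m≤n⇒m≤1+n (m≤n+m r (k * 2)))))) (ps 0 k refl)
  block-signature {r} {h} final f≈g (vs , ps) =
    trans (f≈g z<s) (Valleys.top vs) , trans (f≈g (s≤s (s≤s (m≤n+m r (h * 2))))) (ps 0 h refl)
  block-signature {r} {h} linked f≈g (vs , fp0 , _) =
    trans (f≈g z<s) (Valleys.top vs) , trans (f≈g (s≤s (s≤s (m≤n⇒m≤1+n (m≤n+m r (h * 2)))))) fp0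

  mutual
    family-signature : ∀ {r} s h n → r ≤ 1 → Admissible r h s → All (SignatureFrom r s h) (family r s h n)
    family-signature {r} s h n r≤1 adm = All.++⁺
      (All.map⁺ (All.universal (λ g → h , ≤-refl ,
        block-signature s (splice-left (size r h s) (block r h s) g) (block-isBlock r h s r≤1 adm)) (remainders s n)))
      (All.map (λ { (k , h<k , sig) → k , <⇒≤ h<k , sig }) (further-signature s h n r≤1 adm))

    further-signature : ∀ {r} s h n → r ≤ 1 → Admissible r h s → All (SignatureFrom r s (suc h)) (further r s h n)
    further-signature s h zero          _   _   = []
    further-signature s h (suc zero)    _   _   = []
    further-signature s h (suc (suc n)) r≤1 adm = family-signature s (suc h) n r≤1 (Admissible-suc s adm)

  -- Pairwise distinctness of the listed functions

  Distinct : ℕ → List (ℕ → ℕ) → Set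
  Distinct n = AllPairs (λ f g → ¬ Agree n f g)

  cross : ∀ {n} {P Q : (ℕ → ℕ) → Set} {xs ys} → (∀ {f g} → P f → Q g → ¬ Agree n f g) →
          All P xs → All Q ys → All (λ f → All (λ g → ¬ Agree n f g) ys) xs
  cross apart ps qs = All.map (λ pf → All.map (apart pf) qs) ps

  f0-apart : ∀ r h k {n f g} → 0 < n → f 0 ≡ valley r h → g 0 ≡ valley r k → Agree n f g → h ≡ k
  f0-apart r h k 0<n f0 g0 f≈g = Positions.v-injective r h k (trans (sym f0) (trans (f≈g 0<n) g0))

  splice-distinct : ∀ {m n b xs} → Distinct n xs → Distinct (m + n) (map (splice m b) xs)
  splice-distinct {m} {n} {b} distinct = AllPairs.map⁺ (AllPairs.map still-apart distinct)
    where
    still-apart : ∀ {f g} → ¬ Agree n f g → ¬ Agree (m + n) (splice m b f) (splice m b g)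
    still-apart apart eq = apart (splice-cancel {b = b} eq)

  nested-final-apart : ∀ {r n f g} → peak r 0 < n → SignatureFrom r nested 0 f → SignatureFrom r final 1 g → ¬ Agree n f g
  nested-final-apart {r} p0<n (h , _ , f0 , fp) (suc k , _ , g0 , gp) f≈g with f0-apart r h (suc k) (≤-trans z<s p0<n) f0 g0 f≈g
  ... | refl =
    <⇒≢ (Positions.p<p r k (suc k) ≤-refl) (trans (sym (fp k refl)) (trans (f≈g p0<n) gp))

  nested-linked-apart : ∀ {r n f g} → peak r 0 < n → SignatureFrom r nested 0 f → SignatureFrom r linked 1 g → ¬ Agree n f g
  nested-linked-apart {r} p0<n (h , _ , f0 , fp) (suc k , _ , g0 , gp) f≈g with f0-apart r h (suc k) (≤-trans z<s p0<n) f0 g0 f≈g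
  ... | refl =
    Positions.v≢p r (suc (suc k)) k (trans (sym gp) (trans (sym (f≈g p0<n)) (fp k refl)))

  final-linked-apart : ∀ {r n f g} → peak r 0 < n → SignatureFrom r final 1 f → SignatureFrom r linked 1 g → ¬ Agree n f g
  final-linked-apart {r} p0<n (h , _ , f0 , fp) (k , _ , g0 , gp) f≈g with f0-apart r h k (≤-trans z<s p0<n) f0 g0 f≈g
  ... | refl = Positions.v≢p r (suc h) h (trans (sym gp) (trans (sym (f≈g p0<n)) fp))

  larger-signature : ∀ r n → r ≤ 1 → All (λ f → SignatureFrom r final 1 f ⊎ SignatureFrom r linked 1 f) (larger r n)
  larger-signature r zero                      _   = []
  larger-signature r (suc zero)                _   = []
  larger-signature r (suc (suc zero))          _   = []
  larger-signature r (suc (suc (suc zero)))    r≤1 = All.++⁺ (All.map inj₁ (family-signature final 1 0 r≤1 ≤-refl)) []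
  larger-signature r (suc (suc (suc (suc n)))) r≤1 = All.++⁺ (All.map inj₁ (family-signature final 1 (suc n) r≤1 ≤-refl))
    (All.map inj₂ (family-signature linked 1 n r≤1 ≤-refl))

  remainders-distinct : ∀ s n → (Distinct n (rai n)) → Distinct n (remainders s n)
  remainders-distinct final  zero    _ = [] ∷ []
  remainders-distinct final  (suc n) _ = []
  remainders-distinct nested n       d = d
  remainders-distinct linked n       d = d

  mutual
    rai-distinct : ∀ n → Distinct n (rai n)
    rai-distinct zero          = [] ∷ []
    rai-distinct (suc zero)    = [] ∷ []
    rai-distinct (suc (suc n)) = AllPairs.++⁺ (family-distinct nested 0 n ≤-refl refl) (larger-distinct 1 n ≤-refl)
      (nested-larger-apart n (family-signature nested 0 n ≤-refl refl))

    nested-larger-apart : ∀ n {xs} → All (SignatureFrom 1 nested 0) xs →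
                          All (λ f → All (λ g → ¬ Agree (suc (suc n)) f g) (larger 1 n)) xs
    nested-larger-apart zero    _  = All.universal (λ _ → []) _
    nested-larger-apart (suc n) ss = cross
      (λ s → [ nested-final-apart (s≤s (s≤s (s≤s z≤n))) s , nested-linked-apart (s≤s (s≤s (s≤s z≤n))) s ]′)
      ss (larger-signature 1 (suc n) ≤-refl)

    larger-distinct : ∀ r n → r ≤ 1 → Distinct (suc (r + n)) (larger r n)
    larger-distinct r zero                      _   = []
    larger-distinct r (suc zero)                _   = []
    larger-distinct r (suc (suc zero))          _   = []
    larger-distinct r (suc (suc (suc zero)))    r≤1 = AllPairs.++⁺ (final-distinct r 0 r≤1) [] (All.universal (λ _ → []) _)
    larger-distinct r (suc (suc (suc (suc n)))) r≤1 = AllPairs.++⁺ (final-distinct r (suc n) r≤1)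
      (subst (λ m → Distinct m (family r linked 1 n)) (size-linked r n) (family-distinct linked 1 n r≤1 ≤-refl))
      (cross (final-linked-apart (s≤s (m<m+n r z<s)))
        (family-signature final 1 (suc n) r≤1 ≤-refl) (family-signature linked 1 n r≤1 ≤-refl))

    final-distinct : ∀ r n → r ≤ 1 → Distinct (suc (r + (3 + n))) (family r final 1 n)
    final-distinct r n r≤1 = subst (λ m → Distinct m (family r final 1 n)) (size-final r n) (family-distinct final 1 n r≤1 ≤-refl)

    family-distinct : ∀ {r} s h n → r ≤ 1 → Admissible r h s → Distinct (size r h s + n) (family r s h n)
    family-distinct {r} s h n r≤1 adm = AllPairs.++⁺
      (splice-distinct {size r h s} {b = block r h s} (remainders-distinct s n (rai-distinct n)))
      (further-distinct s h n r≤1 adm)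
      (cross (λ { {f} {g} f0 (k , h<k , sig) f≈g → <⇒≢ h<k (f0-apart r h k (≤-trans (size>0 r h s) (m≤m+n _ n)) f0 (signature-0 s sig) f≈g) })
        (All.map⁺ (All.universal (λ g → signature-0 s (block-signature s (splice-left (size r h s) (block r h s) g) (block-isBlock r h s r≤1 adm))) (remainders s n)))
        (further-signature s h n r≤1 adm))

    further-distinct : ∀ {r} s h n → r ≤ 1 → Admissible r h s → Distinct (size r h s + n) (further r s h n)
    further-distinct s h zero          _ _ = []
    further-distinct s h (suc zero)    _ _ = []
    further-distinct {r} s h (suc (suc n)) r≤1 adm = subst (λ m → Distinct m (family r s (suc h) n)) (size-further r h s n)
      (family-distinct s (suc h) n r≤1 (Admissible-suc s adm))

  ai-distinct : ∀ n → Distinct n (ai n)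
  ai-distinct zero    = [] ∷ []
  ai-distinct (suc n) = AllPairs.++⁺ (splice-distinct {1} {b = id} (rai-distinct n)) (larger-distinct 0 n z≤n)
    (cross (λ f0 → [ apart final f0 , apart linked f0 ]′) (All.map⁺ (All.universal (λ _ → refl) (rai n))) (larger-signature 0 n z≤n))
    where
    apart : ∀ s {f g} → f 0 ≡ valley 0 0 → SignatureFrom 0 s 1 g → ¬ Agree (suc n) f g
    apart s {f} f0 (k , 1≤k , sig) f≈g = <⇒≢ 1≤k (f0-apart 0 0 k {f = f} z<s f0 (signature-0 s sig) f≈g)

  -- Permutations and functions

  toFun : ∀ {n} → Permutation′ n → ℕ → ℕ
  toFun {n} π i with i <? n
  ... | yes i<n = toℕ (π ⟨$⟩ʳ fromℕ< i<n)
  ... | no _    = i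

  toFun-toℕ : ∀ {n} (π : Permutation′ n) x → toFun π (toℕ x) ≡ toℕ (π ⟨$⟩ʳ x)
  toFun-toℕ {n} π x with toℕ x <? n
  ... | yes x<n = cong (toℕ ∘ (π ⟨$⟩ʳ_)) (Fin.fromℕ<-toℕ x x<n)
  ... | no x≮n  = contradiction (Fin.toℕ<n x) x≮n

  toFun-fromℕ< : ∀ {n i} (π : Permutation′ n) (i<n : i < n) → toFun π i ≡ toℕ (π ⟨$⟩ʳ fromℕ< i<n)
  toFun-fromℕ< π i<n = trans (cong (toFun π) (sym (Fin.toℕ-fromℕ< i<n))) (toFun-toℕ π (fromℕ< i<n))

  toFun-cong : ∀ {n} {π ρ : Permutation′ n} → π ≈ ρ → Agree n (toFun π) (toFun ρ)
  toFun-cong {π = π} {ρ} π≈ρ i<n =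
    trans (toFun-fromℕ< π i<n) (trans (cong toℕ (π≈ρ (fromℕ< i<n))) (sym (toFun-fromℕ< ρ i<n)))

  toFun-injective : ∀ {n} {π ρ : Permutation′ n} → Agree n (toFun π) (toFun ρ) → π ≈ ρ
  toFun-injective {π = π} {ρ} eq x =
    Fin.toℕ-injective (trans (sym (toFun-toℕ π x)) (trans (eq (Fin.toℕ<n x)) (toFun-toℕ ρ x)))

  fromFun : ∀ {r n f} → Good r n f → ∃ λ (π : Permutation′ n) → Agree n (toFun π) f
  fromFun {r} {n} {f} good = π , λ i<n → trans (toFun-fromℕ< π i<n)
      (trans (Fin.toℕ-fromℕ< (bounded (Fin.toℕ<n (fromℕ< i<n)))) (cong f (Fin.toℕ-fromℕ< i<n)))
    where
    open Good good
    g : Fin n → Fin n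
    g x = fromℕ< (bounded (Fin.toℕ<n x))
    g-involutive : ∀ x → g (g x) ≡ x
    g-involutive x = Fin.toℕ-injective (trans (Fin.toℕ-fromℕ< (bounded (Fin.toℕ<n (g x))))
      (trans (cong f (Fin.toℕ-fromℕ< (bounded (Fin.toℕ<n x)))) (involutive (Fin.toℕ<n x))))
    π : Permutation′ n
    π = permutation g g g-involutive g-involutive

  parity-valley : ∀ r i → parity (valley r i) ≡ parity r
  parity-valley r zero    = refl
  parity-valley r (suc i) = parity-valley r i

  parity-peak : ∀ r i → parity (peak r i) ≡ parity (suc r)
  parity-peak r zero    = refl
  parity-peak r (suc i) = parity-peak r i

  -- A common form of `Alternating` (`r = 0`) and `ReverseAlternating` (`r = 1`), so that `toGood`
  -- serves both.
  record Zigzag {n : ℕ} (r : ℕ) (π : Permutation′ n) : Set where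
    field
      zig : ∀ x y → toℕ y ≡ suc (toℕ x) → parity (toℕ x) ≡ parity r → π ⟨$⟩ʳ x Fin.< π ⟨$⟩ʳ y
      zag : ∀ x y → toℕ y ≡ suc (toℕ x) → parity (toℕ x) ≡ parity (suc r) → π ⟨$⟩ʳ y Fin.< π ⟨$⟩ʳ x

  module _ {n : ℕ} {π : Permutation′ n} where

    private
      f : ℕ → ℕ
      f = toFun π

    adjacent : ∀ {i} (i+1<n : suc i < n) → toℕ (fromℕ< i+1<n) ≡ suc (toℕ (fromℕ< (<⇒≤ i+1<n)))
    adjacent i+1<n = trans (Fin.toℕ-fromℕ< i+1<n) (cong suc (sym (Fin.toℕ-fromℕ< (<⇒≤ i+1<n))))

    -- One direction of the order isomorphism is enough, because the values of `τ` are linearly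
    -- ordered and `τ` is injective.
    occurrence : ∀ (τ : Permutation′ 4) (ι : Fin 4 → Fin n) → (∀ a b → a Fin.< b → ι a Fin.< ι b) →
                 (∀ a b → τ ⟨$⟩ʳ a Fin.< τ ⟨$⟩ʳ b → π ⟨$⟩ʳ ι a Fin.< π ⟨$⟩ʳ ι b) → IsOccurrence τ π ι
    occurrence τ ι increasing monotone = increasing , λ a b → mk⇔ (reflects a b) (monotone a b)
      where
      reflects : ∀ a b → π ⟨$⟩ʳ ι a Fin.< π ⟨$⟩ʳ ι b → τ ⟨$⟩ʳ a Fin.< τ ⟨$⟩ʳ b
      reflects a b lt with <-cmp (toℕ (τ ⟨$⟩ʳ a)) (toℕ (τ ⟨$⟩ʳ b))
      ... | tri< τ< _ _ = τ<
      ... | tri> _ _ τ> = contradiction lt (<-asym (monotone b a τ>))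
      ... | tri≈ _ eq _ = contradiction (cong (toℕ ∘ (π ⟨$⟩ʳ_) ∘ ι)
              (trans (sym (inverseˡ τ)) (trans (cong (τ ⟨$⟩ˡ_) (Fin.toℕ-injective eq)) (inverseˡ τ)))) (<⇒≢ lt)

    toGood : ∀ {r} → r ≤ 1 → Zigzag r π → Involution π → Avoids p2341 π → Good r n f
    toGood {r} r≤1 zigzag inv avoids = record
      { bounded = λ i<n → subst (_< n) (sym (toFun-fromℕ< π i<n)) (Fin.toℕ<n _)
      ; involutive = λ {i} i<n → trans (cong f (toFun-fromℕ< π i<n)) (trans (toFun-toℕ π _)
          (trans (cong toℕ (trans (inv _) (inverseˡ π))) (Fin.toℕ-fromℕ< i<n)))
      ; avoids2341 = avoids2341
      ; first = λ { refl 1<n → zag-at 0 1<n refl }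
      ; rise = λ i lt → subst₂ _<_ (sym (toFun-fromℕ< π (<⇒≤ lt))) (sym (toFun-fromℕ< π lt))
          (zig _ _ (adjacent lt) (trans (cong parity (Fin.toℕ-fromℕ< (<⇒≤ lt))) (parity-valley r i)))
      ; fall = λ i lt → zag-at (peak r i) lt (parity-peak r i)
      }
      where
      open Zigzag zigzag
      zag-at : ∀ i → suc i < n → parity i ≡ parity (suc r) → f (suc i) < f i
      zag-at i lt eq = subst₂ _<_ (sym (toFun-fromℕ< π lt)) (sym (toFun-fromℕ< π (<⇒≤ lt)))
        (zag _ _ (adjacent lt) (trans (cong parity (Fin.toℕ-fromℕ< (<⇒≤ lt))) eq))
      avoids2341 : ∀ {a b c d} → a < b → b < c → c < d → d < n → f d < f a → f a < f b → f b < f c → ⊥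
      avoids2341 {a} {b} {c} {d} a<b b<c c<d d<n fd<fa fa<fb fb<fc = avoids (ι , occurrence p2341 ι increasing monotone)
        where
        c<n : c < n
        c<n = <-trans c<d d<n
        b<n : b < n
        b<n = <-trans b<c c<n
        a<n : a < n
        a<n = <-trans a<b b<n
        ι : Fin 4 → Fin n
        ι = fromℕ< a<n ∷ᶠ fromℕ< b<n ∷ᶠ fromℕ< c<n ∷ᶠ fromℕ< d<n ∷ᶠ []ᶠ
        at : ∀ {x y} (x<n : x < n) (y<n : y < n) → x < y → fromℕ< x<n Fin.< fromℕ< y<n
        at x<n y<n = subst₂ _<_ (sym (Fin.toℕ-fromℕ< x<n)) (sym (Fin.toℕ-fromℕ< y<n))
        val : ∀ {x y} (x<n : x < n) (y<n : y < n) → f x < f y → π ⟨$⟩ʳ fromℕ< x<n Fin.< π ⟨$⟩ʳ fromℕ< y<n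
        val x<n y<n = subst₂ _<_ (toFun-fromℕ< π x<n) (toFun-fromℕ< π y<n)
        increasing : ∀ x y → x Fin.< y → ι x Fin.< ι y
        increasing 0F 1F _ = at a<n b<n a<b
        increasing 0F 2F _ = at a<n c<n (<-trans a<b b<c)
        increasing 0F 3F _ = at a<n d<n (<-trans a<b (<-trans b<c c<d))
        increasing 1F 2F _ = at b<n c<n b<c
        increasing 1F 3F _ = at b<n d<n (<-trans b<c c<d)
        increasing 2F 3F _ = at c<n d<n c<d
        increasing 0F 0F ()
        increasing 1F 0F ()
        increasing 1F 1F (s≤s ())
        increasing 2F 0F ()
        increasing 2F 1F (s≤s ())
        increasing 2F 2F (s≤s (s≤s ()))
        increasing 3F 0F ()
        increasing 3F 1F (s≤s ())
        increasing 3F 2F (s≤s (s≤s ()))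
        increasing 3F 3F (s≤s (s≤s (s≤s ())))
        monotone : ∀ x y → p2341 ⟨$⟩ʳ x Fin.< p2341 ⟨$⟩ʳ y → π ⟨$⟩ʳ ι x Fin.< π ⟨$⟩ʳ ι y
        monotone 3F 0F _ = val d<n a<n fd<fa
        monotone 3F 1F _ = val d<n b<n (<-trans fd<fa fa<fb)
        monotone 3F 2F _ = val d<n c<n (<-trans fd<fa (<-trans fa<fb fb<fc))
        monotone 0F 1F _ = val a<n b<n fa<fb
        monotone 0F 2F _ = val a<n c<n (<-trans fa<fb fb<fc)
        monotone 1F 2F _ = val b<n c<n fb<fc
        monotone 3F 3F ()
        monotone 0F 3F ()
        monotone 0F 0F (s≤s ())
        monotone 1F 3F ()
        monotone 1F 0F (s≤s ())
        monotone 1F 1F (s≤s (s≤s ()))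
        monotone 2F 3F ()
        monotone 2F 0F (s≤s ())
        monotone 2F 1F (s≤s (s≤s ()))
        monotone 2F 2F (s≤s (s≤s (s≤s ())))

    module FromGood {r : ℕ} (r≤1 : r ≤ 1) (good : Good r n f) where
      open Good good

      lower : ∀ {x y} → f (toℕ x) < f (toℕ y) → π ⟨$⟩ʳ x Fin.< π ⟨$⟩ʳ y
      lower {x} {y} = subst₂ _<_ (toFun-toℕ π x) (toFun-toℕ π y)

      lift : ∀ {x y} → π ⟨$⟩ʳ x Fin.< π ⟨$⟩ʳ y → f (toℕ x) < f (toℕ y)
      lift {x} {y} = subst₂ _<_ (sym (toFun-toℕ π x)) (sym (toFun-toℕ π y))

      involution : Involution π
      involution x = trans (sym (inverseˡ π)) (cong (π ⟨$⟩ˡ_) (Fin.toℕ-injective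
        (trans (sym (toFun-toℕ π (π ⟨$⟩ʳ x))) (trans (cong f (sym (toFun-toℕ π x))) (involutive (Fin.toℕ<n x))))))

      avoids-2341 : Avoids p2341 π
      avoids-2341 (ι , increasing , iso) = avoids2341
        (increasing 0F 1F (s≤s z≤n)) (increasing 1F 2F (s≤s (s≤s z≤n))) (increasing 2F 3F (s≤s (s≤s (s≤s z≤n)))) (Fin.toℕ<n (ι 3F))
        (lift (Equivalence.from (iso 3F 0F) (s≤s z≤n)))
        (lift (Equivalence.from (iso 0F 1F) (s≤s (s≤s z≤n))))
        (lift (Equivalence.from (iso 1F 2F) (s≤s (s≤s (s≤s z≤n)))))

      -- An occurrence of 4123 in an involution is, read along its values, an occurrence of 2341.
      avoids-4123 : Avoids p4123 π
      avoids-4123 (ι , increasing , iso) = avoids2341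
        (lift (Equivalence.from (iso 1F 2F) (s≤s z≤n)))
        (lift (Equivalence.from (iso 2F 3F) (s≤s (s≤s z≤n))))
        (lift (Equivalence.from (iso 3F 0F) (s≤s (s≤s (s≤s z≤n)))))
        (bounded (Fin.toℕ<n (ι 0F)))
        (back 0F 1F (s≤s z≤n)) (back 1F 2F (s≤s (s≤s z≤n))) (back 2F 3F (s≤s (s≤s (s≤s z≤n))))
        where
        back : ∀ a b → a Fin.< b → f (f (toℕ (ι a))) < f (f (toℕ (ι b)))
        back a b a<b = subst₂ _<_ (sym (involutive (Fin.toℕ<n (ι a)))) (sym (involutive (Fin.toℕ<n (ι b)))) (increasing a b a<b)

      step : ∀ x y → toℕ y ≡ suc (toℕ x) →
             (parity (toℕ x) ≡ parity r × π ⟨$⟩ʳ x Fin.< π ⟨$⟩ʳ y) ⊎ (parity (toℕ x) ≡ parity (suc r) × π ⟨$⟩ʳ y Fin.< π ⟨$⟩ʳ x)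
      step x y eq = cases (place r≤1 (toℕ x))
        where
        cases : Place r (toℕ x) → _
        cases (start refl eq′) = inj₂ (cong parity eq′ , lower (subst₂ (λ s t → f s < f t) (sym (trans eq (cong suc eq′))) (sym eq′)
          (first refl (subst (_< n) (trans eq (cong suc eq′)) (Fin.toℕ<n y)))))
        cases (at-valley i eq′) = inj₁ (trans (cong parity eq′) (parity-valley r i) ,
          lower (subst₂ (λ s t → f s < f t) (sym eq′) (sym (trans eq (cong suc eq′)))
            (rise i (subst (_< n) (trans eq (cong suc eq′)) (Fin.toℕ<n y)))))
        cases (at-peak i eq′) = inj₂ (trans (cong parity eq′) (parity-peak r i) ,
          lower (subst₂ (λ s t → f s < f t) (sym (trans eq (cong suc eq′))) (sym eq′)
            (fall i (subst (_< n) (trans eq (cong suc eq′)) (Fin.toℕ<n y)))))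

  parity-suc : ∀ m {n} → parity m ≡ parity n → parity (suc m) ≡ parity (suc n)
  parity-suc m {n} eq = ⁻¹-injective (trans (suc-homo-⁻¹ m) (trans eq (sym (suc-homo-⁻¹ n))))

  module _ {n : ℕ} {π : Permutation′ n} where

    distinct-values : ∀ {x y} → toℕ y ≡ suc (toℕ x) → toℕ (π ⟨$⟩ʳ x) ≢ toℕ (π ⟨$⟩ʳ y)
    distinct-values eq e = 1+n≢n (trans (sym eq) (cong toℕ (sym
      (trans (sym (inverseˡ π)) (trans (cong (π ⟨$⟩ˡ_) (Fin.toℕ-injective e)) (inverseˡ π))))))

    -- `OddPosition` counts from 1, so an odd index is an even position.
    ¬-at-even-position : ∀ {A : Set} (x : Fin n) → parity (toℕ x) ≡ 1ℙ → A ⇔ OddPosition x → ¬ A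
    ¬-at-even-position x even iff a = contradiction (trans (sym (Equivalence.to iff a)) (parity-suc (toℕ x) {1} even)) λ ()

    AI⇒Good : AI n p4123 p2341 π → Good 0 n (toFun π)
    AI⇒Good ((alternating , involution) , _ , avoids) = toGood z≤n zigzag involution avoids
      where
      zigzag : Zigzag 0 π
      zigzag = record
        { zig = λ x y eq odd → Equivalence.from (alternating x y eq) (parity-suc (toℕ x) {0} odd)
        ; zag = λ x y eq even → ≤∧≢⇒< (≮⇒≥ (¬-at-even-position x even (alternating x y eq))) (distinct-values eq ∘ sym)
        }

    RAI⇒Good : RAI n p4123 p2341 π → Good 1 n (toFun π)
    RAI⇒Good ((alternating , involution) , _ , avoids) = toGood ≤-refl zigzag involution avoids
      where
      zigzag : Zigzag 1 π
      zigzag = record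
        { zig = λ x y eq even → ≤∧≢⇒< (≮⇒≥ (¬-at-even-position x even (alternating x y eq))) (distinct-values eq)
        ; zag = λ x y eq odd → Equivalence.from (alternating x y eq) (parity-suc (toℕ x) {0} odd)
        }

    Good⇒AI : Good 0 n (toFun π) → AI n p4123 p2341 π
    Good⇒AI good = (alternating , involution) , avoids-4123 , avoids-2341
      where
      open FromGood {π = π} z≤n good
      alternating : Alternating π
      alternating x y eq with step x y eq
      ... | inj₁ (odd , lt)  = mk⇔ (λ _ → parity-suc (toℕ x) {0} odd) (λ _ → lt)
      ... | inj₂ (even , gt) = mk⇔ (λ lt → contradiction lt (<-asym gt))
                                   (λ odd → contradiction (trans (sym odd) (parity-suc (toℕ x) {1} even)) λ ())

    Good⇒RAI : Good 1 n (toFun π) → RAI n p4123 p2341 π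
    Good⇒RAI good = (alternating , involution) , avoids-4123 , avoids-2341
      where
      open FromGood {π = π} ≤-refl good
      alternating : ReverseAlternating π
      alternating x y eq with step x y eq
      ... | inj₂ (odd , gt)  = mk⇔ (λ _ → parity-suc (toℕ x) {0} odd) (λ _ → gt)
      ... | inj₁ (even , lt) = mk⇔ (λ gt → contradiction gt (<-asym lt))
                                   (λ odd → contradiction (trans (sym odd) (parity-suc (toℕ x) {1} even)) λ ())

  -- Counting by comparison of two lists

  AllPairs-lookup : ∀ {A : Set} {S : A → A → Set} {xs} → AllPairs S xs → ∀ {i j} → i Fin.< j → S (lookup xs i) (lookup xs j)
  AllPairs-lookup {xs = x ∷ xs} (s ∷ _) {Fin.zero}  {Fin.suc j} _   = All.lookup s (∈-lookup j)
  AllPairs-lookup {xs = x ∷ xs} (_ ∷ p) {Fin.suc i} {Fin.suc j} i<j = AllPairs-lookup p (s≤s⁻¹ i<j)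

  -- Choosing for each entry of `xs` the index of a partner in `ys` is injective. A relation takes
  -- the place of a map because permutations and functions are only compared pointwise, by `_≈_` and
  -- `Agree`.
  pigeonhole : ∀ {A B : Set} {R : A → B → Set} {_~_ : A → A → Set} {xs ys} →
               (∀ {x y z} → R x z → R y z → x ~ y) → AllPairs (λ x y → ¬ x ~ y) xs →
               All (λ x → Any (R x) ys) xs → length xs ≤ length ys
  pigeonhole {R = R} {xs = xs} {ys} join apart matched = Fin.injective⇒≤ {f = partner} injective
    where
    match : ∀ i → Any (R (lookup xs i)) ys
    match i = All.lookup matched (∈-lookup i)
    partner : Fin (length xs) → Fin (length ys)
    partner i = Any.index (match i)
    related : ∀ {i j} → partner i ≡ partner j → R (lookup xs j) (lookup ys (partner i))
    related {i} {j} eq = subst (λ k → R (lookup xs j) (lookup ys k)) (sym eq) (Any.lookup-index (match j))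
    injective : ∀ {i j} → partner i ≡ partner j → i ≡ j
    injective {i} {j} eq with Fin.<-cmp i j
    ... | tri< i<j _ _ = contradiction (join (Any.lookup-index (match i)) (related eq)) (AllPairs-lookup apart i<j)
    ... | tri≈ _ i≡j _ = i≡j
    ... | tri> _ _ j<i = contradiction (join (related eq) (Any.lookup-index (match i))) (AllPairs-lookup apart j<i)

  module _ {r n : ℕ} {P : Pred (Permutation′ n) 0ℓ} (P? : Decidable P)
           (to : ∀ {π} → P π → Good r n (toFun π)) (from : ∀ {π} → Good r n (toFun π) → P π)
           {xs : List (ℕ → ℕ)} (sound : All (Good r n) xs) (complete : ∀ {f} → Good r n f → Listed n f xs)
           (distinct : Distinct n xs) where

    count : ∣ P? ∣ ≡ length xs
    count = ≤-antisym
      (pigeonhole {R = λ π → Agree n (toFun π)} {_~_ = _≈_} {ys = xs}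
        (λ {π} {ρ} π~f ρ~f → toFun-injective {π = π} {ρ} (λ i<n → trans (π~f i<n) (sym (ρ~f i<n))))
        (AllPairs.filter⁺ P? (permutations-unique n))
        (All.map (λ pπ → complete (to pπ)) (All.all-filter P? (permutations n))))
      (pigeonhole {R = λ f π → Agree n (toFun π) f} {_~_ = Agree n} {ys = filter P? (permutations n)}
        (λ π~f π~g i<n → trans (sym (π~f i<n)) (π~g i<n))
        distinct
        (All.map found sound))
      where
      -- `P` is equivalent to a property of `toFun π` on positions below `n`, hence compatible with
      -- `_≈_`.
      resp : ∀ {π ρ} → π ≈ ρ → P π → P ρ
      resp {π} {ρ} π≈ρ pπ = from (Good-resp (toFun-cong {π = π} {ρ} π≈ρ) (to pπ))
      found : ∀ {f} → Good r n f → Any (λ π → Agree n (toFun π) f) (filter P? (permutations n))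
      found {f} good with fromFun good
      ... | π , π~f = Any.map (λ {ρ} π≈ρ {i} i<n → trans (sym (toFun-cong {π = π} {ρ} π≈ρ i<n)) (π~f i<n))
        (∈-filter⁺ (permutationSetoid n) P? (λ {π} {ρ} → resp {π} {ρ}) (permutations-complete π)
          (from (Good-resp (λ i<n → sym (π~f i<n)) good)))

  count-RAI : ∀ n → ∣ RAI? n p4123 p2341 ∣ ≡ length (rai n)
  count-RAI n = count (RAI? n p4123 p2341) RAI⇒Good Good⇒RAI (rai-good n) (rai-complete n) (rai-distinct n)

  count-AI : ∀ n → ∣ AI? n p4123 p2341 ∣ ≡ length (ai n)
  count-AI n = count (AI? n p4123 p2341) AI⇒Good Good⇒AI (ai-good n) (ai-complete n) (ai-distinct n)

import Data.Integer.Properties as ℤ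
open import Algebra.Properties.CommutativeMonoid.Sum ℤ.+-0-commutativeMonoid using (sum; sum-cong-≋)
open import Data.Fin.Base using (toℕ)
open import Data.Integer.Base as ℤ using (ℤ; 0ℤ; 1ℤ)
import Data.Integer.Tactic.RingSolver as ℤSolver
open import Data.List.Base using (length; map; _++_)
open import Data.List.Properties using (length-++; length-map)
open import Data.Nat.Base as ℕ using (ℕ; zero; suc; s≤s)
import Data.Nat.Properties as ℕ
import Data.Nat.Tactic.RingSolver as ℕSolver
open import Data.Product.Base using (_×_; _,_)
open import Defs
open import Function.Base using (_∘_)
import Relation.Binary.Reasoning.Setoid as SetoidReasoning
open import Relation.Binary.PropositionalEquality using (_≡_; _≗_; refl; sym; trans; cong; cong₂; _→-setoid_; module ≡-Reasoning)
open Involutions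

-- Recurrences for the numbers of members

#rai #ai : ℕ → ℕ
#rai n = length (rai n)
#ai n = length (ai n)

-- The length of `family r s h n` depends on neither `r` nor `h`: it adds up the numbers of
-- remainders of lengths `n`, `n - 2`, ....
#family : Shape → ℕ → ℕ
#family s (suc (suc n)) = length (remainders s (suc (suc n))) ℕ.+ #family s n
#family s n             = length (remainders s n)

length-family : ∀ r s h n → length (family r s h n) ≡ #family s n
length-family r s h n = trans (length-++ (map _ (remainders s n)))
  (trans (cong (ℕ._+ length (further r s h n)) (length-map _ (remainders s n))) (rest n))
  where
  rest : ∀ n → length (remainders s n) ℕ.+ length (further r s h n) ≡ #family s n
  rest zero          = ℕ.+-identityʳ _
  rest (suc zero)    = ℕ.+-identityʳ _
  rest (suc (suc n)) = cong (length (remainders s (suc (suc n))) ℕ.+_) (length-family r s (suc h) n)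

#family-linked : ∀ n → #family linked n ≡ #family nested n
#family-linked zero          = refl
#family-linked (suc zero)    = refl
#family-linked (suc (suc n)) = cong (#rai (suc (suc n)) ℕ.+_) (#family-linked n)

#family-final-even : ∀ m → #family final (m ℕ.* 2) ≡ 1
#family-final-even zero    = refl
#family-final-even (suc m) = #family-final-even m

#family-final-odd : ∀ m → #family final (suc (m ℕ.* 2)) ≡ 0
#family-final-odd zero    = refl
#family-final-odd (suc m) = #family-final-odd m

length-larger : ∀ r n → length (larger r (4 ℕ.+ n)) ≡ #family final (suc n) ℕ.+ #family nested n
length-larger r n = trans (length-++ (family r final 1 (suc n)))
  (cong₂ ℕ._+_ (length-family r final 1 (suc n)) (trans (length-family r linked 1 n) (#family-linked n)))

#rai-+6 : ∀ n → #rai (6 ℕ.+ n) ≡ #family nested (4 ℕ.+ n) ℕ.+ (#family final (suc n) ℕ.+ #family nested n)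
#rai-+6 n = trans (length-++ (family 1 nested 0 (4 ℕ.+ n))) (cong₂ ℕ._+_ (length-family 1 nested 0 (4 ℕ.+ n)) (length-larger 1 n))

#ai-+5 : ∀ n → #ai (5 ℕ.+ n) ≡ #rai (4 ℕ.+ n) ℕ.+ (#family final (suc n) ℕ.+ #family nested n)
#ai-+5 n = trans (length-++ (map _ (rai (4 ℕ.+ n)))) (cong₂ ℕ._+_ (length-map _ (rai (4 ℕ.+ n))) (length-larger 0 n))

-- The sums in `#rai-+6` telescope. When the length grows by two, each of the two nested terms gains
-- one value of `#rai`, while the final term keeps its value; the old terms add up to another value
-- of `#rai`.
#rai-recurrence : ∀ n → #rai (6 ℕ.+ n) ≡ 2 ℕ.* #rai (4 ℕ.+ n) ℕ.+ #rai n
#rai-recurrence zero          = refl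
#rai-recurrence (suc zero)    = refl
#rai-recurrence (suc (suc n)) = begin
  #rai (8 ℕ.+ n)
    ≡⟨ #rai-+6 (2 ℕ.+ n) ⟩
  R ℕ.+ S₄ ℕ.+ (E ℕ.+ (R₂ ℕ.+ S))
    ≡⟨ rearrange R S₄ E R₂ S ⟩
  R ℕ.+ (S₄ ℕ.+ (E ℕ.+ S)) ℕ.+ R₂
    ≡⟨ cong (λ z → R ℕ.+ z ℕ.+ R₂) (sym (#rai-+6 n)) ⟩
  R ℕ.+ R ℕ.+ R₂
    ≡⟨ cong (λ z → R ℕ.+ z ℕ.+ R₂) (sym (ℕ.+-identityʳ R)) ⟩
  2 ℕ.* R ℕ.+ R₂
    ∎
  where
  open ≡-Reasoning
  R R₂ S S₄ E : ℕ
  R  = #rai (6 ℕ.+ n)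
  R₂ = #rai (2 ℕ.+ n)
  S  = #family nested n
  S₄ = #family nested (4 ℕ.+ n)
  E  = #family final (suc n)
  rearrange : ∀ r s₄ e r₂ s → r ℕ.+ s₄ ℕ.+ (e ℕ.+ (r₂ ℕ.+ s)) ≡ r ℕ.+ (s₄ ℕ.+ (e ℕ.+ s)) ℕ.+ r₂
  rearrange = ℕSolver.solve-∀

recurrence-+ : ∀ a a′ b b′ → (2 ℕ.* a ℕ.+ a′) ℕ.+ (2 ℕ.* b ℕ.+ b′) ≡ 2 ℕ.* (a ℕ.+ b) ℕ.+ (a′ ℕ.+ b′)
recurrence-+ = ℕSolver.solve-∀

-- The recurrence of the denominator `1 - 2y - y^3`, where `y` stands for `x^2`.
Recurrent : (ℕ → ℕ) → Set
Recurrent c = ∀ m → c (3 ℕ.+ m) ≡ 2 ℕ.* c (2 ℕ.+ m) ℕ.+ c m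

+-recurrent : ∀ {a b c : ℕ → ℕ} → (∀ m → c m ≡ a m ℕ.+ b m) → Recurrent a → Recurrent b → Recurrent c
+-recurrent {a} {b} {c} c≡ rec-a rec-b m = begin
  c (3 ℕ.+ m)
    ≡⟨ trans (c≡ (3 ℕ.+ m)) (cong₂ ℕ._+_ (rec-a m) (rec-b m)) ⟩
  (2 ℕ.* a (2 ℕ.+ m) ℕ.+ a m) ℕ.+ (2 ℕ.* b (2 ℕ.+ m) ℕ.+ b m)
    ≡⟨ recurrence-+ (a (2 ℕ.+ m)) (a m) (b (2 ℕ.+ m)) (b m) ⟩
  2 ℕ.* (a (2 ℕ.+ m) ℕ.+ b (2 ℕ.+ m)) ℕ.+ (a m ℕ.+ b m)
    ≡⟨ sym (cong₂ (λ s t → 2 ℕ.* s ℕ.+ t) (c≡ (2 ℕ.+ m)) (c≡ m)) ⟩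
  2 ℕ.* c (2 ℕ.+ m) ℕ.+ c m
    ∎
  where
  open ≡-Reasoning

recurrent-unique : ∀ {a b} → Recurrent a → Recurrent b → a 0 ≡ b 0 → a 1 ≡ b 1 → a 2 ≡ b 2 → ∀ m → a m ≡ b m
recurrent-unique _ _ eq₀ _ _ zero = eq₀
recurrent-unique {a} {b} rec-a rec-b eq₀ eq₁ eq₂ (suc m) =
  recurrent-unique {a ∘ suc} {b ∘ suc} (rec-a ∘ suc) (rec-b ∘ suc) eq₁ eq₂
    (trans (rec-a 0) (trans (cong₂ (λ s t → 2 ℕ.* s ℕ.+ t) eq₂ eq₀) (sym (rec-b 0)))) m

#rai-even #rai-odd #ai-even #ai-odd : ℕ → ℕ
#rai-even m = #rai (m ℕ.* 2)
#rai-odd m  = #rai (suc (m ℕ.* 2))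
#ai-even m  = #ai (m ℕ.* 2)
#ai-odd m   = #ai (suc (m ℕ.* 2))

#rai-even-recurrent : Recurrent #rai-even
#rai-even-recurrent m = #rai-recurrence (m ℕ.* 2)

#rai-odd-recurrent : Recurrent #rai-odd
#rai-odd-recurrent m = #rai-recurrence (suc (m ℕ.* 2))

#nested-even-recurrent : Recurrent (λ m → #family nested (m ℕ.* 2))
#nested-even-recurrent zero    = refl
#nested-even-recurrent (suc m) = begin
  R 4 ℕ.+ S 3
    ≡⟨ cong₂ ℕ._+_ (#rai-even-recurrent (suc m)) (#nested-even-recurrent m) ⟩
  (2 ℕ.* R 3 ℕ.+ R 1) ℕ.+ (2 ℕ.* S 2 ℕ.+ S 0)
    ≡⟨ recurrence-+ (R 3) (R 1) (S 2) (S 0) ⟩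
  2 ℕ.* (R 3 ℕ.+ S 2) ℕ.+ (R 1 ℕ.+ S 0)
    ∎
  where
  open ≡-Reasoning
  R S : ℕ → ℕ
  R i = #rai-even (i ℕ.+ m)
  S i = #family nested ((i ℕ.+ m) ℕ.* 2)

-- The argument is numerical, without a bijection: from length 5 on both sequences satisfy the same
-- recurrence, and the initial values are computed. Final blocks do not contribute to `#ai-odd`, as
-- their length is even for `r = 0`.
#ai-odd≡#rai-odd : ∀ m → #ai-odd m ≡ #rai-odd m
#ai-odd≡#rai-odd zero          = refl
#ai-odd≡#rai-odd (suc zero)    = refl
#ai-odd≡#rai-odd (suc (suc m)) = recurrent-unique {λ m → #ai-odd (2 ℕ.+ m)} {λ m → #rai-odd (2 ℕ.+ m)}
  (+-recurrent {λ m → #rai-even (2 ℕ.+ m)} {λ m → #family nested (m ℕ.* 2)}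
    (λ m → trans (#ai-+5 (m ℕ.* 2)) (cong (λ z → #rai-even (2 ℕ.+ m) ℕ.+ (z ℕ.+ #family nested (m ℕ.* 2))) (#family-final-odd m)))
    (λ m → #rai-even-recurrent (2 ℕ.+ m)) #nested-even-recurrent)
  (λ m → #rai-odd-recurrent (2 ℕ.+ m)) refl refl refl m

-- A comparison of coefficients in `U * AIₑ` and `Q * RAIₒ`, with the negative terms moved across to
-- stay in ℕ.
#ai-even-step : ∀ m → #ai-even (3 ℕ.+ m) ℕ.+ #rai-odd (1 ℕ.+ m) ≡ #ai-even (2 ℕ.+ m) ℕ.+ (#rai-odd (2 ℕ.+ m) ℕ.+ #rai-odd m)
#ai-even-step zero    = refl
#ai-even-step (suc m) = begin
  #ai-even (4 ℕ.+ m) ℕ.+ R 2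
    ≡⟨ cong (ℕ._+ R 2) (#ai-+5 (3 ℕ.+ m ℕ.* 2)) ⟩
  R 3 ℕ.+ (E ℕ.+ (R 1 ℕ.+ S)) ℕ.+ R 2
    ≡⟨ rearrange (R 3) E (R 1) S (R 2) ⟩
  R 2 ℕ.+ (E ℕ.+ S) ℕ.+ (R 3 ℕ.+ R 1)
    ≡⟨ cong (ℕ._+ (R 3 ℕ.+ R 1)) (sym (#ai-+5 (suc (m ℕ.* 2)))) ⟩
  #ai-even (3 ℕ.+ m) ℕ.+ (R 3 ℕ.+ R 1)
    ∎
  where
  open ≡-Reasoning
  R : ℕ → ℕ
  R i = #rai-odd (i ℕ.+ m)
  E S : ℕ
  E = #family final (2 ℕ.+ m ℕ.* 2)
  S = #family nested (suc (m ℕ.* 2))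
  rearrange : ∀ r₃ e r₁ s r₂ → r₃ ℕ.+ (e ℕ.+ (r₁ ℕ.+ s)) ℕ.+ r₂ ≡ r₂ ℕ.+ (e ℕ.+ s) ℕ.+ (r₃ ℕ.+ r₁)
  rearrange = ℕSolver.solve-∀

-- Power series

shift : PowerSeries → PowerSeries
shift f zero    = 0ℤ
shift f (suc n) = f n

shift-cong : ∀ {f g} → f ≗ g → shift f ≗ shift g
shift-cong f≗g zero    = refl
shift-cong f≗g (suc n) = f≗g n

*-cong : ∀ {f f′ g g′} → f ≗ f′ → g ≗ g′ → f * g ≗ f′ * g′
*-cong f≗ g≗ n = sum-cong-≋ {suc n} λ i → cong₂ ℤ._*_ (f≗ (toℕ i)) (g≗ (n ℕ.∸ toℕ i))

*-distribʳ-+ : ∀ f g h → (f + g) * h ≗ f * h + g * h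
*-distribʳ-+ f g h zero    = lemma (f 0) (g 0) (h 0)
  where
  lemma : ∀ a b c → (a ℤ.+ b) ℤ.* c ℤ.+ 0ℤ ≡ (a ℤ.* c ℤ.+ 0ℤ) ℤ.+ (b ℤ.* c ℤ.+ 0ℤ)
  lemma = ℤSolver.solve-∀
-- By computation `(f * g) (suc n)` is `f 0 ℤ.* g (suc n) ℤ.+ ((f ∘ suc) * g) n`, so the induction
-- passes to the left factor without its constant term.
*-distribʳ-+ f g h (suc n) =
  trans (cong (ℤ._+_ ((f 0 ℤ.+ g 0) ℤ.* h (suc n))) (*-distribʳ-+ (f ∘ suc) (g ∘ suc) h n))
        (lemma (f 0) (g 0) (h (suc n)) (((f ∘ suc) * h) n) (((g ∘ suc) * h) n))
  where
  lemma : ∀ a b c s t → (a ℤ.+ b) ℤ.* c ℤ.+ (s ℤ.+ t) ≡ (a ℤ.* c ℤ.+ s) ℤ.+ (b ℤ.* c ℤ.+ t)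
  lemma = ℤSolver.solve-∀

scale : ℤ → PowerSeries → PowerSeries
scale c f n = c ℤ.* f n

scale-* : ∀ c f h → scale c f * h ≗ scale c (f * h)
scale-* c f h zero    = lemma c (f 0) (h 0)
  where
  lemma : ∀ c a b → (c ℤ.* a) ℤ.* b ℤ.+ 0ℤ ≡ c ℤ.* (a ℤ.* b ℤ.+ 0ℤ)
  lemma = ℤSolver.solve-∀
scale-* c f h (suc n) =
  trans (cong (ℤ._+_ ((c ℤ.* f 0) ℤ.* h (suc n))) (scale-* c (f ∘ suc) h n)) (lemma c (f 0) (h (suc n)) (((f ∘ suc) * h) n))
  where
  lemma : ∀ c a b s → (c ℤ.* a) ℤ.* b ℤ.+ c ℤ.* s ≡ c ℤ.* (a ℤ.* b ℤ.+ s)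
  lemma = ℤSolver.solve-∀

*-distribʳ-minus : ∀ f g h → (f - g) * h ≗ f * h - g * h
*-distribʳ-minus f g h n = trans (*-cong {g = h} (λ i → neg (f i) (g i)) (λ _ → refl) n)
  (trans (*-distribʳ-+ f (scale ℤ.-1ℤ g) h n)
    (trans (cong (ℤ._+_ ((f * h) n)) (scale-* ℤ.-1ℤ g h n)) (sym (neg ((f * h) n) ((g * h) n)))))
  where
  neg : ∀ a b → a ℤ.- b ≡ a ℤ.+ ℤ.-1ℤ ℤ.* b
  neg = ℤSolver.solve-∀

-- The product unfolds by itself at its first summand only; splitting off the last one is what
-- `*-comm` needs.
*-suc : ∀ f g n → (f * g) (suc n) ≡ (f * (g ∘ suc)) n ℤ.+ f (suc n) ℤ.* g 0
*-suc f g zero    = lemma (f 0 ℤ.* g 1) (f 1 ℤ.* g 0)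
  where
  lemma : ∀ a b → a ℤ.+ (b ℤ.+ 0ℤ) ≡ (a ℤ.+ 0ℤ) ℤ.+ b
  lemma = ℤSolver.solve-∀
*-suc f g (suc n) = trans (cong (ℤ._+_ (f 0 ℤ.* g (suc (suc n)))) (*-suc (f ∘ suc) g n))
  (sym (ℤ.+-assoc (f 0 ℤ.* g (suc (suc n))) (((f ∘ suc) * (g ∘ suc)) n) (f (suc (suc n)) ℤ.* g 0)))

*-comm : ∀ f g → f * g ≗ g * f
*-comm f g zero    = cong (ℤ._+ 0ℤ) (ℤ.*-comm (f 0) (g 0))
*-comm f g (suc n) = trans (cong (ℤ._+_ (f 0 ℤ.* g (suc n))) (*-comm (f ∘ suc) g n))
  (trans (lemma (f 0) (g (suc n)) ((g * (f ∘ suc)) n)) (sym (*-suc g f n)))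
  where
  lemma : ∀ a b s → a ℤ.* b ℤ.+ s ≡ s ℤ.+ b ℤ.* a
  lemma = ℤSolver.solve-∀

*-assoc : ∀ f g h → (f * g) * h ≗ f * (g * h)
*-assoc f g h zero    = lemma (f 0) (g 0) (h 0)
  where
  lemma : ∀ a b c → (a ℤ.* b ℤ.+ 0ℤ) ℤ.* c ℤ.+ 0ℤ ≡ a ℤ.* (b ℤ.* c ℤ.+ 0ℤ) ℤ.+ 0ℤ
  lemma = ℤSolver.solve-∀
*-assoc f g h (suc n) = begin
  -- `(f * g) ∘ suc` is by computation the sum in the left factor, which distributivity then splits.
  (f * g) 0 ℤ.* h (suc n) ℤ.+ ((scale (f 0) (g ∘ suc) + (f ∘ suc) * g) * h) n
    ≡⟨ cong (ℤ._+_ ((f * g) 0 ℤ.* h (suc n)))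
         (trans (*-distribʳ-+ (scale (f 0) (g ∘ suc)) ((f ∘ suc) * g) h n)
                (cong₂ ℤ._+_ (scale-* (f 0) (g ∘ suc) h n) (*-assoc (f ∘ suc) g h n))) ⟩
  (f 0 ℤ.* g 0 ℤ.+ 0ℤ) ℤ.* h (suc n) ℤ.+ (f 0 ℤ.* ((g ∘ suc) * h) n ℤ.+ ((f ∘ suc) * (g * h)) n)
    ≡⟨ lemma (f 0) (g 0) (h (suc n)) (((g ∘ suc) * h) n) (((f ∘ suc) * (g * h)) n) ⟩
  f 0 ℤ.* (g 0 ℤ.* h (suc n) ℤ.+ ((g ∘ suc) * h) n) ℤ.+ ((f ∘ suc) * (g * h)) n
    ∎
  where
  open ≡-Reasoning
  lemma : ∀ a b c s t → (a ℤ.* b ℤ.+ 0ℤ) ℤ.* c ℤ.+ (a ℤ.* s ℤ.+ t) ≡ a ℤ.* (b ℤ.* c ℤ.+ s) ℤ.+ t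
  lemma = ℤSolver.solve-∀

*-zeroˡ : ∀ f → (λ _ → 0ℤ) * f ≗ (λ _ → 0ℤ)
*-zeroˡ f zero    = refl
*-zeroˡ f (suc n) = trans (ℤ.+-identityˡ _) (*-zeroˡ f n)

*-identityˡ : ∀ f → 𝟙 * f ≗ f
*-identityˡ f zero    = trans (ℤ.+-identityʳ _) (ℤ.*-identityˡ (f 0))
*-identityˡ f (suc n) = trans (cong₂ ℤ._+_ (ℤ.*-identityˡ (f (suc n))) (*-zeroˡ f n)) (ℤ.+-identityʳ _)

*-identityʳ : ∀ f → f * 𝟙 ≗ f
*-identityʳ f n = trans (*-comm f 𝟙 n) (*-identityˡ f n)

x-* : ∀ f → x * f ≗ shift f
x-* f zero    = refl
x-* f (suc n) = trans (ℤ.+-identityˡ _) (*-identityˡ f n)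

divide : ∀ f g {h} → g 0 ≡ 1ℤ → g * f ≗ h → f ≗ h * inverse g
divide f g {h} g₀≡1 g*f≗h n = begin
  f n                         ≡⟨ sym (*-identityʳ f n) ⟩
  (f * 𝟙) n                   ≡⟨ *-cong {f} (λ _ → refl) (λ i → sym (*-inverse g g₀≡1 i)) n ⟩
  (f * (g * inverse g)) n     ≡⟨ sym (*-assoc f g (inverse g) n) ⟩
  ((f * g) * inverse g) n     ≡⟨ *-cong {g = inverse g} (λ i → trans (*-comm f g i) (g*f≗h i)) (λ _ → refl) n ⟩
  (h * inverse g) n           ∎
  where open ≡-Reasoning

shiftBy : ℕ → PowerSeries → PowerSeries
shiftBy zero    f = f
shiftBy (suc k) f = shift (shiftBy k f)

x^-* : ∀ k f → x ^ k * f ≗ shiftBy k f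
x^-* zero    f   = *-identityˡ f
x^-* (suc k) f n = trans (*-assoc x (x ^ k) f n) (trans (x-* (x ^ k * f) n) (shift-cong (x^-* k f) n))

x^≗ : ∀ k → x ^ k ≗ shiftBy k 𝟙
x^≗ k n = trans (sym (*-identityʳ (x ^ k) n)) (x^-* k 𝟙 n)

spread : (ℕ → ℕ) → PowerSeries
spread c zero          = ℤ.+ c 0
spread c (suc zero)    = 0ℤ
spread c (suc (suc n)) = spread (c ∘ suc) n

spread-cong : ∀ {c d} → c ≗ d → spread c ≗ spread d
spread-cong c≗d zero          = cong ℤ.+_ (c≗d 0)
spread-cong c≗d (suc zero)    = refl
spread-cong c≗d (suc (suc n)) = spread-cong (c≗d ∘ suc) n

sum-zero : ∀ N (c : ℕ → ℕ) → sum {N} (λ i → ℤ.+ c (toℕ i) ℤ.* 0ℤ) ≡ 0ℤ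
sum-zero zero    c = refl
sum-zero (suc N) c = cong₂ ℤ._+_ (ℤ.*-zeroʳ (ℤ.+ c 0)) (sum-zero N (c ∘ suc))

-- A summand can be nonzero only at the index `i` with `2i = n`; the bound on `n` keeps this index
-- in range.
sum-spread : ∀ N c n → n ℕ.< N ℕ.* 2 → sum {N} (λ i → ℤ.+ c (toℕ i) ℤ.* shiftBy (toℕ i ℕ.* 2) 𝟙 n) ≡ spread c n
sum-spread (suc N) c zero          _ = trans (cong₂ ℤ._+_ (ℤ.*-identityʳ (ℤ.+ c 0)) (sum-zero N (c ∘ suc))) (ℤ.+-identityʳ _)
sum-spread (suc N) c (suc zero)    _ = cong₂ ℤ._+_ (ℤ.*-zeroʳ (ℤ.+ c 0)) (sum-zero N (c ∘ suc))
sum-spread (suc N) c (suc (suc n)) (s≤s (s≤s n<)) =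
  trans (cong₂ ℤ._+_ (ℤ.*-zeroʳ (ℤ.+ c 0)) (sum-spread N (c ∘ suc) n n<)) (ℤ.+-identityˡ _)

even-series : ∀ (c d : ℕ → ℕ) → (∀ m → c (m ℕ.* 2) ≡ d m) → ∑∞[ m ] (c (2 ℕ.* m) · x ^ (2 ℕ.* m)) ≗ spread d
even-series c d c≡d n = trans
  (sum-cong-≋ {suc n} λ i → cong₂ (λ a b → ℤ.+ a ℤ.* b)
    (trans (cong c (ℕ.*-comm 2 (toℕ i))) (c≡d (toℕ i)))
    (trans (cong (λ e → (x ^ e) n) (ℕ.*-comm 2 (toℕ i))) (x^≗ (toℕ i ℕ.* 2) n)))
  (sum-spread (suc n) d n (ℕ.m≤m*n (suc n) 2))

odd-series : ∀ (c d : ℕ → ℕ) → (∀ m → c (suc (m ℕ.* 2)) ≡ d m) →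
             ∑∞[ m ] (c (2 ℕ.* m ℕ.+ 1) · x ^ (2 ℕ.* m ℕ.+ 1)) ≗ shift (spread d)
odd-series c d c≡d n = trans
  (sum-cong-≋ {suc n} λ i → cong₂ (λ a b → ℤ.+ a ℤ.* b)
    (trans (cong c (odd (toℕ i))) (c≡d (toℕ i)))
    (trans (cong (λ e → (x ^ e) n) (odd (toℕ i))) (x^≗ (suc (toℕ i ℕ.* 2)) n)))
  (shifted n)
  where
  odd : ∀ m → 2 ℕ.* m ℕ.+ 1 ≡ suc (m ℕ.* 2)
  odd m = trans (ℕ.+-comm (2 ℕ.* m) 1) (cong suc (ℕ.*-comm 2 m))
  shifted : ∀ n → sum {suc n} (λ i → ℤ.+ d (toℕ i) ℤ.* shift (shiftBy (toℕ i ℕ.* 2) 𝟙) n) ≡ shift (spread d) n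
  shifted zero    = sum-zero 1 d
  shifted (suc n) = sum-spread (suc (suc n)) d n (ℕ.≤-trans (ℕ.m≤m*n (suc n) 2) (ℕ.*-monoˡ-≤ 2 (ℕ.n≤1+n (suc n))))

-- Identification with the rational functions

D U Q : PowerSeries
D = 𝟙 - 2 · x ^ 2 - x ^ 6
U = 𝟙 - x ^ 2
Q = x ^ 5 - x ^ 3 + x

D-* : ∀ f n → (D * f) n ≡ f n ℤ.- ℤ.+ 2 ℤ.* shiftBy 2 f n ℤ.- shiftBy 6 f n
D-* f n = trans (*-distribʳ-minus (𝟙 - 2 · x ^ 2) (x ^ 6) f n) (cong₂ ℤ._-_
  (trans (*-distribʳ-minus 𝟙 (2 · x ^ 2) f n) (cong₂ ℤ._-_ (*-identityˡ f n)
    (trans (scale-* (ℤ.+ 2) (x ^ 2) f n) (cong (ℤ.+ 2 ℤ.*_) (x^-* 2 f n)))))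
  (x^-* 6 f n))

U-* : ∀ f n → (U * f) n ≡ f n ℤ.- shiftBy 2 f n
U-* f n = trans (*-distribʳ-minus 𝟙 (x ^ 2) f n) (cong₂ ℤ._-_ (*-identityˡ f n) (x^-* 2 f n))

Q-* : ∀ f n → (Q * f) n ≡ shiftBy 5 f n ℤ.- shiftBy 3 f n ℤ.+ shift f n
Q-* f n = trans (*-distribʳ-+ (x ^ 5 - x ^ 3) x f n) (cong₂ ℤ._+_
  (trans (*-distribʳ-minus (x ^ 5) (x ^ 3) f n) (cong₂ ℤ._-_ (x^-* 5 f n) (x^-* 3 f n))) (x-* f n))

U≗ : ∀ n → U n ≡ 𝟙 n ℤ.- shiftBy 2 𝟙 n
U≗ n = cong (ℤ._-_ (𝟙 n)) (x^≗ 2 n)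

Q≗ : ∀ n → Q n ≡ shiftBy 5 𝟙 n ℤ.- shiftBy 3 𝟙 n ℤ.+ x n
Q≗ n = cong (ℤ._+ x n) (cong₂ ℤ._-_ (x^≗ 5 n) (x^≗ 3 n))

-- The left side is the coefficient of `D * spread c` at `6 + n`, since three steps of `c` are six
-- powers of `x`.
spread-recurrence : ∀ {c} → Recurrent c → ∀ n →
  spread (λ m → c (3 ℕ.+ m)) n ℤ.- ℤ.+ 2 ℤ.* spread (λ m → c (2 ℕ.+ m)) n ℤ.- spread c n ≡ 0ℤ
spread-recurrence {c} rec zero = trans (cong (λ z → ℤ.+ z ℤ.- ℤ.+ 2 ℤ.* ℤ.+ c 2 ℤ.- ℤ.+ c 0) (rec 0))
  (trans (cong (λ z → z ℤ.- ℤ.+ 2 ℤ.* ℤ.+ c 2 ℤ.- ℤ.+ c 0)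
    (trans (ℤ.pos-+ (2 ℕ.* c 2) (c 0)) (cong (ℤ._+ (ℤ.+ c 0)) (ℤ.pos-* 2 (c 2)))))
    (cancel (ℤ.+ c 2) (ℤ.+ c 0)))
  where
  cancel : ∀ a b → (ℤ.+ 2 ℤ.* a ℤ.+ b) ℤ.- ℤ.+ 2 ℤ.* a ℤ.- b ≡ 0ℤ
  cancel = ℤSolver.solve-∀
spread-recurrence rec (suc zero)    = refl
spread-recurrence {c} rec (suc (suc n)) = spread-recurrence {c ∘ suc} (rec ∘ suc) n

-- The two sides are the coefficients at `6 + n` of `U * spread a` and `Q * shift (spread b)`.
spread-even-step : ∀ {a b : ℕ → ℕ} → (∀ m → a (3 ℕ.+ m) ℕ.+ b (1 ℕ.+ m) ≡ a (2 ℕ.+ m) ℕ.+ (b (2 ℕ.+ m) ℕ.+ b m)) → ∀ n →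
  spread (λ m → a (3 ℕ.+ m)) n ℤ.- spread (λ m → a (2 ℕ.+ m)) n
    ≡ spread b n ℤ.- spread (λ m → b (1 ℕ.+ m)) n ℤ.+ spread (λ m → b (2 ℕ.+ m)) n
spread-even-step {a} {b} step zero = rearrange (ℤ.+ a 3) (ℤ.+ a 2) (ℤ.+ b 0) (ℤ.+ b 1) (ℤ.+ b 2) (begin
  ℤ.+ a 3 ℤ.+ (ℤ.+ b 1)
    ≡⟨ sym (ℤ.pos-+ (a 3) (b 1)) ⟩
  ℤ.+ (a 3 ℕ.+ b 1)
    ≡⟨ cong ℤ.+_ (step 0) ⟩
  ℤ.+ (a 2 ℕ.+ (b 2 ℕ.+ b 0))
    ≡⟨ trans (ℤ.pos-+ (a 2) (b 2 ℕ.+ b 0)) (cong (ℤ._+_ (ℤ.+ a 2)) (ℤ.pos-+ (b 2) (b 0))) ⟩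
  ℤ.+ a 2 ℤ.+ (ℤ.+ b 2 ℤ.+ (ℤ.+ b 0))
    ∎)
  where
  open ≡-Reasoning
  solve₁ : ∀ a₃ a₂ b₁ → a₃ ℤ.- a₂ ≡ (a₃ ℤ.+ b₁) ℤ.- b₁ ℤ.- a₂
  solve₁ = ℤSolver.solve-∀
  solve₂ : ∀ a₂ b₀ b₁ b₂ → (a₂ ℤ.+ (b₂ ℤ.+ b₀)) ℤ.- b₁ ℤ.- a₂ ≡ b₀ ℤ.- b₁ ℤ.+ b₂
  solve₂ = ℤSolver.solve-∀
  rearrange : ∀ a₃ a₂ b₀ b₁ b₂ → a₃ ℤ.+ b₁ ≡ a₂ ℤ.+ (b₂ ℤ.+ b₀) → a₃ ℤ.- a₂ ≡ b₀ ℤ.- b₁ ℤ.+ b₂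
  rearrange a₃ a₂ b₀ b₁ b₂ eq = trans (solve₁ a₃ a₂ b₁) (trans (cong (λ z → z ℤ.- b₁ ℤ.- a₂) eq) (solve₂ a₂ b₀ b₁ b₂))
spread-even-step step (suc zero)    = refl
spread-even-step {a} {b} step (suc (suc n)) = spread-even-step {a ∘ suc} {b ∘ suc} (step ∘ suc) n

RAIₑ RAIₒ AIₑ : PowerSeries
RAIₑ = spread #rai-even
RAIₒ = shift (spread #rai-odd)
AIₑ  = spread #ai-even

D*RAIₑ : D * RAIₑ ≗ U
D*RAIₑ n = trans (D-* RAIₑ n) (trans (coefficients n) (sym (U≗ n)))
  where
  coefficients : ∀ n → RAIₑ n ℤ.- ℤ.+ 2 ℤ.* shiftBy 2 RAIₑ n ℤ.- shiftBy 6 RAIₑ n ≡ 𝟙 n ℤ.- shiftBy 2 𝟙 n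
  coefficients 0 = refl
  coefficients 1 = refl
  coefficients 2 = refl
  coefficients 3 = refl
  coefficients 4 = refl
  coefficients 5 = refl
  coefficients (suc (suc (suc (suc (suc (suc n)))))) = spread-recurrence {#rai-even} #rai-even-recurrent n

D*RAIₒ : D * RAIₒ ≗ Q
D*RAIₒ n = trans (D-* RAIₒ n) (trans (coefficients n) (sym (Q≗ n)))
  where
  coefficients : ∀ n → RAIₒ n ℤ.- ℤ.+ 2 ℤ.* shiftBy 2 RAIₒ n ℤ.- shiftBy 6 RAIₒ n ≡ shiftBy 5 𝟙 n ℤ.- shiftBy 3 𝟙 n ℤ.+ x n
  coefficients 0 = refl
  coefficients 1 = refl
  coefficients 2 = refl
  coefficients 3 = refl
  coefficients 4 = refl
  coefficients 5 = refl
  coefficients 6 = refl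
  -- The factor `x` in `RAIₒ` delays the recurrence by one coefficient compared with `RAIₑ`; `Q` has
  -- degree 5, so its coefficients are already exhausted.
  coefficients (suc (suc (suc (suc (suc (suc (suc n))))))) = spread-recurrence {#rai-odd} #rai-odd-recurrent n

-- After division by `U`, the 1 counts the empty permutation, `x ^ 4 / U` the final blocks, and
-- `Q / U`, which is x + x^5/(1 - x^2), the fixed point and the linked blocks in front of a member
-- of odd length.
U*AIₑ : U * AIₑ ≗ (U + x ^ 4) + Q * RAIₒ
U*AIₑ n = trans (U-* AIₑ n) (trans (coefficients n) (sym (cong₂ ℤ._+_ (cong₂ ℤ._+_ (U≗ n) (x^≗ 4 n)) (Q-* RAIₒ n))))
  where
  coefficients : ∀ n → AIₑ n ℤ.- shiftBy 2 AIₑ n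
    ≡ (𝟙 n ℤ.- shiftBy 2 𝟙 n ℤ.+ shiftBy 4 𝟙 n) ℤ.+ (shiftBy 5 RAIₒ n ℤ.- shiftBy 3 RAIₒ n ℤ.+ shift RAIₒ n)
  coefficients 0 = refl
  coefficients 1 = refl
  coefficients 2 = refl
  coefficients 3 = refl
  coefficients 4 = refl
  coefficients 5 = refl
  coefficients (suc (suc (suc (suc (suc (suc n)))))) =
    trans (spread-even-step {#ai-even} {#rai-odd} #ai-even-step n) (sym (ℤ.+-identityˡ _))

*-congˡ : ∀ f {g h} → g ≗ h → f * g ≗ f * h
*-congˡ f g≗h = *-cong {f} (λ _ → refl) g≗h

*-congʳ : ∀ h {f g} → f ≗ g → f * h ≗ g * h
*-congʳ h f≗g = *-cong {g = h} f≗g (λ _ → refl)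

*-divide : ∀ f g → g 0 ≡ 1ℤ → g * (f * inverse g) ≗ f
*-divide f g g₀≡1 = begin
  g * (f * inverse g)  ≈⟨ *-congˡ g (*-comm f (inverse g)) ⟩
  g * (inverse g * f)  ≈⟨ (λ n → sym (*-assoc g (inverse g) f n)) ⟩
  (g * inverse g) * f  ≈⟨ *-congʳ f (*-inverse g g₀≡1) ⟩
  𝟙 * f                ≈⟨ *-identityˡ f ⟩
  f                    ∎
  where open SetoidReasoning (ℕ →-setoid ℤ)

Q*RAIₒ/U : (Q * RAIₒ) / U ≗ Q ^ 2 / (D * U)
Q*RAIₒ/U = divide (Q * RAIₒ / U) (D * U) refl (begin
  (D * U) * (Q * RAIₒ * inverse U)  ≈⟨ *-assoc D U (Q * RAIₒ * inverse U) ⟩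
  D * (U * (Q * RAIₒ * inverse U))  ≈⟨ *-congˡ D (*-divide (Q * RAIₒ) U refl) ⟩
  D * (Q * RAIₒ)                    ≈⟨ (λ n → sym (*-assoc D Q RAIₒ n)) ⟩
  (D * Q) * RAIₒ                    ≈⟨ *-congʳ RAIₒ (*-comm D Q) ⟩
  (Q * D) * RAIₒ                    ≈⟨ *-assoc Q D RAIₒ ⟩
  Q * (D * RAIₒ)                    ≈⟨ *-congˡ Q (λ n → trans (D*RAIₒ n) (sym (*-identityʳ Q n))) ⟩
  Q ^ 2                             ∎)
  where open SetoidReasoning (ℕ →-setoid ℤ)

AIₑ≗ : AIₑ ≗ 𝟙 + x ^ 4 / U + Q ^ 2 / (D * U)
AIₑ≗ = begin
  AIₑ
    ≈⟨ divide AIₑ U refl U*AIₑ ⟩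
  ((U + x ^ 4) + Q * RAIₒ) / U
    ≈⟨ *-distribʳ-+ (U + x ^ 4) (Q * RAIₒ) (inverse U) ⟩
  (U + x ^ 4) / U + (Q * RAIₒ) / U
    ≈⟨ (λ n → cong₂ ℤ._+_ (trans (*-distribʳ-+ U (x ^ 4) (inverse U) n)
                             (cong (ℤ._+ (x ^ 4 / U) n) (*-inverse U refl n)))
                           (Q*RAIₒ/U n)) ⟩
  𝟙 + x ^ 4 / U + Q ^ 2 / (D * U)
    ∎
  where open SetoidReasoning (ℕ →-setoid ℤ)

theorem11p3 : ((∑∞[ n ] (∣ AI? (2 ℕ.* n ℕ.+ 1) p4123 p2341 ∣ · x ^ (2 ℕ.* n ℕ.+ 1)))
    ≗ (∑∞[ n ] (∣ RAI? (2 ℕ.* n ℕ.+ 1) p4123 p2341 ∣ · x ^ (2 ℕ.* n ℕ.+ 1))))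
    × ((∑∞[ n ] (∣ RAI? (2 ℕ.* n ℕ.+ 1) p4123 p2341 ∣ · x ^ (2 ℕ.* n ℕ.+ 1)))
    ≗ (x ^ 5 - x ^ 3 + x) / (𝟙 - 2 · x ^ 2 - x ^ 6))
    × ((∑∞[ n ] (∣ RAI? (2 ℕ.* n) p4123 p2341 ∣ · x ^ (2 ℕ.* n)))
    ≗ (𝟙 - x ^ 2) / (𝟙 - 2 · x ^ 2 - x ^ 6))
    × ((∑∞[ n ] (∣ AI? (2 ℕ.* n) p4123 p2341 ∣ · x ^ (2 ℕ.* n)))
    ≗ 𝟙 + x ^ 4 / (𝟙 - x ^ 2)
    + (x ^ 5 - x ^ 3 + x) ^ 2 / ((𝟙 - 2 · x ^ 2 - x ^ 6) * (𝟙 - x ^ 2)))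
theorem11p3 =
    (λ n → trans (ai-odd n) (sym (rai-odd n)))
  , (λ n → trans (rai-odd n) (divide RAIₒ D refl D*RAIₒ n))
  , (λ n → trans (rai-even n) (divide RAIₑ D refl D*RAIₑ n))
  , (λ n → trans (ai-even n) (AIₑ≗ n))
  where
  rai-odd  = odd-series (λ n → ∣ RAI? n p4123 p2341 ∣) #rai-odd (λ m → count-RAI (suc (m ℕ.* 2)))
  ai-odd   = odd-series (λ n → ∣ AI? n p4123 p2341 ∣) #rai-odd
               (λ m → trans (count-AI (suc (m ℕ.* 2))) (#ai-odd≡#rai-odd m))
  rai-even = even-series (λ n → ∣ RAI? n p4123 p2341 ∣) #rai-even (λ m → count-RAI (m ℕ.* 2))
  ai-even  = even-series (λ n → ∣ AI? n p4123 p2341 ∣) #ai-even (λ m → count-AI (m ℕ.* 2))
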